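{- For integers $n\ge 1$ and $k\ge 0$ let $m_n$ be the number of Motzkin trees with $n$ vertices and let $b_{k,n}$ be the total number of balanced vertices of rank $k$ in all Motzkin trees with $n$ vertices, i.e. the number of pairs $(T,v)$ with $T$ a Motzkin tree on $n$ vertices and $v$ a balanced vertex of rank $k$ of $T$. Let $b_k=\lim_{n\to\infty}\frac{b_{k,n}}{n\,m_n}$ be the asymptotic proportion of balanced vertices of rank $k$ among all vertices of all Motzkin trees. Then these limits exist and, for every $k\ge 1$, $$b_k=\tfrac13\,b_{k-1}+\tfrac13\,b_{k-1}^2 .$$
   Context: A Motzkin tree (0-1-2 tree, unary-binary tree) is a rooted plane tree, with at least one vertex, in which every vertex has 0, 1 or 2 children (a single child carries no left/right distinction; two children are ordered). A leaf is a vertex with no children. The rank of a vertex $v$ is the length (number of edges) of the shortest path from $v$ to a leaf travelling strictly from parent to child; leaves have rank 0. A vertex $v$ is balanced if all parent-to-child paths from $v$ to a leaf have the same length; so a balanced vertex of rank $k$ is a vertex for which all such paths have length exactly $k$. -}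

module Defs where

open import Data.Integer using (+_)
open import Data.List using (List; []; _∷_; _++_; length; map; filter; cartesianProductWith)
open import Data.List.Membership.Propositional using (_∈_)
open import Data.List.Membership.Propositional.Properties
  using (∈-map⁺; ∈-map⁻; ∈-++⁺ˡ; ∈-++⁺ʳ; ∈-++⁻; ∈-filter⁺; ∈-filter⁻;
         ∈-cartesianProductWith⁺; ∈-cartesianProductWith⁻)
open import Data.List.NonEmpty as List⁺ using (List⁺; _⁺++⁺_; foldr₁; toList)
open import Data.List.Properties using (length-map; length-++)
open import Data.List.Relation.Unary.All as All using (All; []; _∷_)
open import Data.List.Relation.Unary.AllPairs using (AllPairs; allPairs?; []; _∷_)
open import Data.List.Relation.Unary.Any using (here; there)
open import Data.List.Relation.Unary.Unique.Propositional using (Unique)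
import Data.List.Relation.Unary.Unique.Propositional.Properties as Unique
open import Data.Nat.ListAction using (sum)
open import Data.Nat as ℕ using (ℕ; zero; suc; z≤n; s≤s; NonZero)
import Data.Nat.Properties as ℕ
open import Data.Product using (Σ; ∃; _×_; _,_; proj₁; proj₂)
open import Data.Rational as ℚ using (ℚ; 0ℚ; 1ℚ; Positive)
import Data.Rational.Properties as ℚ
open import Data.Rational.Solver using (module +-*-Solver)
open import Data.Sum using (inj₁; inj₂)
open import Function using (it)
open import Relation.Binary.PropositionalEquality
  using (_≡_; refl; sym; trans; cong; cong₂; subst; subst₂)
open import Relation.Nullary using (Dec; ¬_)
open import Relation.Nullary.Decidable using (_×-dec_)

data Motzkin : Set where
  leaf   : Motzkin
  unary  : Motzkin → Motzkin
  binary : Motzkin → Motzkin → Motzkin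

size : Motzkin → ℕ
size leaf         = 1
size (unary t)    = suc (size t)
size (binary t u) = suc (size t ℕ.+ size u)

data Vertex : Motzkin → Set where
  root  : ∀ {t} → Vertex t
  below : ∀ {t} → Vertex t → Vertex (unary t)
  left  : ∀ {t u} → Vertex t → Vertex (binary t u)
  right : ∀ {t u} → Vertex u → Vertex (binary t u)

-- The tree formed by a vertex and all its descendants.
subtree : ∀ {t} → Vertex t → Motzkin
subtree {t} root  = t
subtree (below v) = subtree v
subtree (left v)  = subtree v
subtree (right v) = subtree v

-- The lengths of all parent-to-child paths from the root of a tree to a
-- leaf, one entry for each such path.
rootPathLengths : Motzkin → List⁺ ℕ
rootPathLengths leaf         = 0 List⁺.∷ []
rootPathLengths (unary t)    = List⁺.map suc (rootPathLengths t)
rootPathLengths (binary t u) =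
  List⁺.map suc (rootPathLengths t ⁺++⁺ rootPathLengths u)

-- A parent-to-child path starting at v stays inside the subtree at v.
pathLengths : ∀ {t} → Vertex t → List⁺ ℕ
pathLengths v = rootPathLengths (subtree v)

rank : ∀ {t} → Vertex t → ℕ
rank v = foldr₁ ℕ._⊓_ (pathLengths v)

Balanced : ∀ {t} → Vertex t → Set
Balanced v = AllPairs _≡_ (toList (pathLengths v))

BalancedOfRank : ℕ → ∀ {t} → Vertex t → Set
BalancedOfRank k v = Balanced v × rank v ≡ k

balancedOfRank? : ∀ k {t} (v : Vertex t) → Dec (BalancedOfRank k v)
balancedOfRank? k v =
  allPairs? ℕ._≟_ (toList (pathLengths v)) ×-dec (rank v ℕ.≟ k)

vertices : (t : Motzkin) → List (Vertex t)
vertices leaf         = root ∷ []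
vertices (unary t)    = root ∷ map below (vertices t)
vertices (binary t u) = root ∷ map left (vertices t) ++ map right (vertices u)

-- All trees in which every root-to-leaf path has fewer than h edges.
treesOfHeight< : ℕ → List Motzkin
treesOfHeight< zero    = []
treesOfHeight< (suc h) =
  leaf ∷ map unary ts ++ cartesianProductWith binary ts ts
  where ts = treesOfHeight< h

-- A tree with n vertices has height less than n, so none is missed; see
-- ∈-trees⁺, ∈-trees⁻ and trees-unique below.
trees : ℕ → List Motzkin
trees n = filter (λ t → size t ℕ.≟ n) (treesOfHeight< n)

#trees : ℕ → ℕ
#trees n = length (trees n)

#balancedIn : ℕ → Motzkin → ℕ
#balancedIn k t = length (filter (balancedOfRank? k) (vertices t))

#balanced : ℕ → ℕ → ℕ
#balanced k n = sum (map (#balancedIn k) (trees n))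

∈-vertices : ∀ {t} (v : Vertex t) → v ∈ vertices t
∈-vertices {leaf} root         = here refl
∈-vertices {unary t} root      = here refl
∈-vertices {unary t} (below v) = there (∈-map⁺ below (∈-vertices v))
∈-vertices {binary t u} root   = here refl
∈-vertices {binary t u} (left v) =
  there (∈-++⁺ˡ (∈-map⁺ left (∈-vertices v)))
∈-vertices {binary t u} (right v) =
  there (∈-++⁺ʳ (map left (vertices t)) (∈-map⁺ right (∈-vertices v)))

vertices-unique : ∀ t → Unique (vertices t)
vertices-unique leaf = [] ∷ []
vertices-unique (unary t) =
  All.tabulate root∉ ∷ Unique.map⁺ (λ { refl → refl }) (vertices-unique t)
  where
  root∉ : ∀ {v} → v ∈ map below (vertices t) → ¬ (root ≡ v)
  root∉ v∈ refl with ∈-map⁻ below v∈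
  ... | _ , _ , ()
vertices-unique (binary t u) =
  All.tabulate root∉ ∷
  Unique.++⁺ (Unique.map⁺ (λ { refl → refl }) (vertices-unique t))
             (Unique.map⁺ (λ { refl → refl }) (vertices-unique u))
             disjoint
  where
  root∉ : ∀ {v} → v ∈ map left (vertices t) ++ map right (vertices u) → ¬ (root ≡ v)
  root∉ v∈ refl with ∈-++⁻ (map left (vertices t)) v∈
  ... | inj₁ v∈ˡ with () ← proj₂ (proj₂ (∈-map⁻ left v∈ˡ))
  ... | inj₂ v∈ʳ with () ← proj₂ (proj₂ (∈-map⁻ right v∈ʳ))
  disjoint : ∀ {v} → ¬ (v ∈ map left (vertices t) × v ∈ map right (vertices u))
  disjoint (v∈ˡ , v∈ʳ) with ∈-map⁻ left v∈ˡ
  ... | _ , _ , refl with () ← proj₂ (proj₂ (∈-map⁻ right v∈ʳ))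

length-vertices : ∀ t → length (vertices t) ≡ size t
length-vertices leaf      = refl
length-vertices (unary t) =
  cong suc (trans (length-map below (vertices t)) (length-vertices t))
length-vertices (binary t u) = cong suc (trans
  (length-++ (map left (vertices t)))
  (cong₂ ℕ._+_ (trans (length-map left (vertices t)) (length-vertices t))
               (trans (length-map right (vertices u)) (length-vertices u))))

∈-treesOfHeight< : ∀ {h} t → size t ℕ.≤ h → t ∈ treesOfHeight< h
∈-treesOfHeight< leaf      (s≤s _) = here refl
∈-treesOfHeight< (unary t) (s≤s p) =
  there (∈-++⁺ˡ (∈-map⁺ unary (∈-treesOfHeight< t p)))
∈-treesOfHeight< {suc h} (binary t u) (s≤s p) =
  there (∈-++⁺ʳ (map unary (treesOfHeight< h))
    (∈-cartesianProductWith⁺ binary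
      (∈-treesOfHeight< t (ℕ.m+n≤o⇒m≤o (size t) p))
      (∈-treesOfHeight< u (ℕ.m+n≤o⇒n≤o (size t) p))))

treesOfHeight<-unique : ∀ h → Unique (treesOfHeight< h)
treesOfHeight<-unique zero    = []
treesOfHeight<-unique (suc h) =
  All.tabulate leaf∉ ∷
  Unique.++⁺ (Unique.map⁺ (λ { refl → refl }) ih)
             (Unique.cartesianProductWith⁺ binary (λ { refl → refl , refl }) ih ih)
             disjoint
  where
  ts = treesOfHeight< h
  ih = treesOfHeight<-unique h
  leaf∉ : ∀ {t} → t ∈ map unary ts ++ cartesianProductWith binary ts ts → ¬ (leaf ≡ t)
  leaf∉ t∈ refl with ∈-++⁻ (map unary ts) t∈
  ... | inj₁ t∈ᵘ with () ← proj₂ (proj₂ (∈-map⁻ unary t∈ᵘ))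
  ... | inj₂ t∈ᵇ with _ , _ , _ , _ , () ← ∈-cartesianProductWith⁻ binary ts ts t∈ᵇ
  disjoint : ∀ {t} → ¬ (t ∈ map unary ts × t ∈ cartesianProductWith binary ts ts)
  disjoint (t∈ᵘ , t∈ᵇ) with ∈-map⁻ unary t∈ᵘ
  ... | _ , _ , refl with _ , _ , _ , _ , () ← ∈-cartesianProductWith⁻ binary ts ts t∈ᵇ

∈-trees⁺ : ∀ {n} t → size t ≡ n → t ∈ trees n
∈-trees⁺ t refl = ∈-filter⁺ (λ u → size u ℕ.≟ size t) (∈-treesOfHeight< t ℕ.≤-refl) refl

∈-trees⁻ : ∀ {n t} → t ∈ trees n → size t ≡ n
∈-trees⁻ {n} t∈ = proj₂ (∈-filter⁻ (λ u → size u ℕ.≟ n) {xs = treesOfHeight< n} t∈)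

trees-unique : ∀ n → Unique (trees n)
trees-unique n = Unique.filter⁺ (λ t → size t ℕ.≟ n) (treesOfHeight<-unique n)

path : ℕ → Motzkin
path zero    = leaf
path (suc n) = unary (path n)

size-path : ∀ n → size (path n) ≡ suc n
size-path zero    = refl
size-path (suc n) = cong suc (size-path n)

#trees-nonZero : ∀ n .{{_ : NonZero n}} → NonZero (#trees n)
#trees-nonZero (suc n) = inhabited (∈-trees⁺ (path n) (size-path n))
  where
  inhabited : ∀ {t : Motzkin} {ts} → t ∈ ts → NonZero (length ts)
  inhabited (here _)  = _
  inhabited (there _) = _

balancedProportion : ∀ k n .{{_ : NonZero n}} → ℚ
balancedProportion k n = + #balanced k n ℚ./ (n ℕ.* #trees n)
  where instance
  n*#trees-nonZero : NonZero (n ℕ.* #trees n)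
  n*#trees-nonZero = ℕ.m*n≢0 n (#trees n) {{it}} {{#trees-nonZero n}}

IsCauchy : (ℕ → ℚ) → Set
IsCauchy a = ∀ ε → 0ℚ ℚ.< ε → ∃ λ N → ∀ m n → N ℕ.≤ m → N ℕ.≤ n →
  ℚ.∣ a m ℚ.- a n ∣ ℚ.< ε

-- Real numbers are Cauchy sequences of rationals, identified up to _≃ᴿ_.
record ℝ : Set where
  constructor mkℝ
  field
    seq    : ℕ → ℚ
    cauchy : IsCauchy seq
open ℝ public

infix  4 _≃ᴿ_ _<ᴿ_
infixl 6 _+ᴿ_ _-ᴿ_
infixl 7 _*ᴿ_

_≃ᴿ_ : ℝ → ℝ → Set
x ≃ᴿ y = ∀ ε → 0ℚ ℚ.< ε → ∃ λ N → ∀ n → N ℕ.≤ n →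
  ℚ.∣ seq x n ℚ.- seq y n ∣ ℚ.< ε

-- The uniform gap δ is needed: a termwise eventual strict inequality would
-- not respect _≃ᴿ_.
_<ᴿ_ : ℝ → ℝ → Set
x <ᴿ y = ∃ λ δ → 0ℚ ℚ.< δ × ∃ λ N → ∀ n → N ℕ.≤ n →
  seq x n ℚ.+ δ ℚ.≤ seq y n

private
  0<½* : ∀ {ε} → 0ℚ ℚ.< ε → 0ℚ ℚ.< ℚ.½ ℚ.* ε
  0<½* {ε} 0<ε = subst (ℚ._< ℚ.½ ℚ.* ε) (ℚ.*-zeroʳ ℚ.½) (ℚ.*-monoʳ-<-pos ℚ.½ 0<ε)

  halves : ∀ ε → ℚ.½ ℚ.* ε ℚ.+ ℚ.½ ℚ.* ε ≡ ε
  halves ε = trans (sym (ℚ.*-distribʳ-+ ε ℚ.½ ℚ.½)) (ℚ.*-identityˡ ε)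

  p≡[p-q]+q : ∀ p q → p ≡ (p ℚ.- q) ℚ.+ q
  p≡[p-q]+q = solve 2 (λ p q → p := (p :- q) :+ q) refl
    where open +-*-Solver

  bounded : ∀ {a} → IsCauchy a → ∃ λ B → 0ℚ ℚ.< B × ∃ λ N → ∀ n → N ℕ.≤ n →
    ℚ.∣ a n ∣ ℚ.≤ B
  bounded {a} ca with ca 1ℚ (ℚ.positive⁻¹ 1ℚ)
  ... | N , close = B , 0<B , N , bound
    where
    open ℚ.≤-Reasoning
    B = 1ℚ ℚ.+ ℚ.∣ a N ∣
    0<B : 0ℚ ℚ.< B
    0<B = ℚ.+-mono-<-≤ {0ℚ} {1ℚ} (ℚ.positive⁻¹ 1ℚ) (ℚ.0≤∣p∣ (a N))
    bound : ∀ n → N ℕ.≤ n → ℚ.∣ a n ∣ ℚ.≤ B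
    bound n N≤n = begin
      ℚ.∣ a n ∣                           ≡⟨ cong ℚ.∣_∣ (p≡[p-q]+q (a n) (a N)) ⟩
      ℚ.∣ (a n ℚ.- a N) ℚ.+ a N ∣         ≤⟨ ℚ.∣p+q∣≤∣p∣+∣q∣ (a n ℚ.- a N) (a N) ⟩
      ℚ.∣ a n ℚ.- a N ∣ ℚ.+ ℚ.∣ a N ∣     ≤⟨ ℚ.+-monoˡ-≤ ℚ.∣ a N ∣ (ℚ.<⇒≤ (close n N N≤n ℕ.≤-refl)) ⟩
      B                                   ∎

  +-cauchy : ∀ {a b} → IsCauchy a → IsCauchy b → IsCauchy (λ n → a n ℚ.+ b n)
  +-cauchy {a} {b} ca cb ε 0<ε with ca (ℚ.½ ℚ.* ε) (0<½* 0<ε) | cb (ℚ.½ ℚ.* ε) (0<½* 0<ε)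
  ... | M , closeᵃ | N , closeᵇ = M ℕ.⊔ N , close
    where
    open ℚ.≤-Reasoning
    regroup : ∀ p q r s → (p ℚ.+ q) ℚ.- (r ℚ.+ s) ≡ (p ℚ.- r) ℚ.+ (q ℚ.- s)
    regroup = solve 4 (λ p q r s → (p :+ q) :- (r :+ s) := (p :- r) :+ (q :- s)) refl
      where open +-*-Solver
    close : ∀ m n → M ℕ.⊔ N ℕ.≤ m → M ℕ.⊔ N ℕ.≤ n →
      ℚ.∣ (a m ℚ.+ b m) ℚ.- (a n ℚ.+ b n) ∣ ℚ.< ε
    close m n ≤m ≤n = begin-strict
      ℚ.∣ (a m ℚ.+ b m) ℚ.- (a n ℚ.+ b n) ∣
        ≡⟨ cong ℚ.∣_∣ (regroup (a m) (b m) (a n) (b n)) ⟩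
      ℚ.∣ (a m ℚ.- a n) ℚ.+ (b m ℚ.- b n) ∣
        ≤⟨ ℚ.∣p+q∣≤∣p∣+∣q∣ (a m ℚ.- a n) (b m ℚ.- b n) ⟩
      ℚ.∣ a m ℚ.- a n ∣ ℚ.+ ℚ.∣ b m ℚ.- b n ∣
        <⟨ ℚ.+-mono-< (closeᵃ m n (ℕ.m⊔n≤o⇒m≤o M N ≤m) (ℕ.m⊔n≤o⇒m≤o M N ≤n))
                      (closeᵇ m n (ℕ.m⊔n≤o⇒n≤o M N ≤m) (ℕ.m⊔n≤o⇒n≤o M N ≤n)) ⟩
      ℚ.½ ℚ.* ε ℚ.+ ℚ.½ ℚ.* ε
        ≡⟨ halves ε ⟩
      ε ∎

  neg-cauchy : ∀ {a} → IsCauchy a → IsCauchy (λ n → ℚ.- a n)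
  neg-cauchy {a} ca ε 0<ε with ca ε 0<ε
  ... | N , close = N , λ m n N≤m N≤n →
    subst (ℚ._< ε)
      (trans (sym (ℚ.∣-p∣≡∣p∣ (a m ℚ.- a n))) (cong ℚ.∣_∣ (ℚ.neg-distrib-+ (a m) (ℚ.- a n))))
      (close m n N≤m N≤n)

  ∣p∣-∣q∣≤∣p-q∣ : ∀ p q → ℚ.∣ p ∣ ℚ.- ℚ.∣ q ∣ ℚ.≤ ℚ.∣ p ℚ.- q ∣
  ∣p∣-∣q∣≤∣p-q∣ p q = begin
    ℚ.∣ p ∣ ℚ.- ℚ.∣ q ∣
      ≡⟨ cong (λ r → ℚ.∣ r ∣ ℚ.- ℚ.∣ q ∣) (p≡[p-q]+q p q) ⟩
    ℚ.∣ (p ℚ.- q) ℚ.+ q ∣ ℚ.- ℚ.∣ q ∣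
      ≤⟨ ℚ.+-monoˡ-≤ (ℚ.- ℚ.∣ q ∣) (ℚ.∣p+q∣≤∣p∣+∣q∣ (p ℚ.- q) q) ⟩
    (ℚ.∣ p ℚ.- q ∣ ℚ.+ ℚ.∣ q ∣) ℚ.- ℚ.∣ q ∣
      ≡⟨ cancel ℚ.∣ p ℚ.- q ∣ ℚ.∣ q ∣ ⟩
    ℚ.∣ p ℚ.- q ∣ ∎
    where
    open ℚ.≤-Reasoning
    cancel : ∀ r s → (r ℚ.+ s) ℚ.- s ≡ r
    cancel = solve 2 (λ r s → (r :+ s) :- s := r) refl
      where open +-*-Solver

  ∣∣p∣-∣q∣∣≤∣p-q∣ : ∀ p q → ℚ.∣ ℚ.∣ p ∣ ℚ.- ℚ.∣ q ∣ ∣ ℚ.≤ ℚ.∣ p ℚ.- q ∣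
  ∣∣p∣-∣q∣∣≤∣p-q∣ p q with ℚ.∣p∣≡p∨∣p∣≡-p (ℚ.∣ p ∣ ℚ.- ℚ.∣ q ∣)
  ... | inj₁ eq = subst (ℚ._≤ ℚ.∣ p ℚ.- q ∣) (sym eq) (∣p∣-∣q∣≤∣p-q∣ p q)
  ... | inj₂ eq = subst₂ ℚ._≤_ (sym (trans eq (swap ℚ.∣ p ∣ ℚ.∣ q ∣)))
      (trans (sym (ℚ.∣-p∣≡∣p∣ (q ℚ.- p))) (cong ℚ.∣_∣ (swap q p)))
      (∣p∣-∣q∣≤∣p-q∣ q p)
    where
    swap : ∀ r s → ℚ.- (r ℚ.- s) ≡ s ℚ.- r
    swap = solve 2 (λ r s → :- (r :- s) := s :- r) refl
      where open +-*-Solver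

  ∣∣-cauchy : ∀ {a} → IsCauchy a → IsCauchy (λ n → ℚ.∣ a n ∣)
  ∣∣-cauchy {a} ca ε 0<ε with ca ε 0<ε
  ... | N , close = N , λ m n N≤m N≤n →
    ℚ.≤-<-trans (∣∣p∣-∣q∣∣≤∣p-q∣ (a m) (a n)) (close m n N≤m N≤n)

  divide : ∀ C ε → 0ℚ ℚ.< C → 0ℚ ℚ.< ε → ∃ λ η → 0ℚ ℚ.< η × C ℚ.* η ≡ ε
  divide C ε 0<C 0<ε =
    ℚ.1/ C ℚ.* ε ,
    subst (ℚ._< ℚ.1/ C ℚ.* ε) (ℚ.*-zeroʳ (ℚ.1/ C)) (ℚ.*-monoʳ-<-pos (ℚ.1/ C) 0<ε) ,
    trans (sym (ℚ.*-assoc C (ℚ.1/ C) ε))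
      (trans (cong (ℚ._* ε) (ℚ.*-inverseʳ C)) (ℚ.*-identityˡ ε))
    where instance
    C-pos : Positive C
    C-pos = ℚ.positive 0<C
    C-nonZero : ℚ.NonZero C
    C-nonZero = ℚ.pos⇒nonZero C
    1/C-pos : Positive (ℚ.1/ C)
    1/C-pos = ℚ.1/pos⇒pos C

  ∣p*q∣< : ∀ {P η} p q → 0ℚ ℚ.< P → ℚ.∣ p ∣ ℚ.≤ P → ℚ.∣ q ∣ ℚ.< η →
    ℚ.∣ p ℚ.* q ∣ ℚ.< P ℚ.* η
  ∣p*q∣< {P} {η} p q 0<P p≤P q<η = begin-strict
    ℚ.∣ p ℚ.* q ∣         ≡⟨ ℚ.∣p*q∣≡∣p∣*∣q∣ p q ⟩
    ℚ.∣ p ∣ ℚ.* ℚ.∣ q ∣   ≤⟨ ℚ.*-monoʳ-≤-nonNeg ℚ.∣ q ∣ {{ℚ.∣-∣-nonNeg q}} p≤P ⟩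
    P ℚ.* ℚ.∣ q ∣         <⟨ ℚ.*-monoʳ-<-pos P {{ℚ.positive 0<P}} q<η ⟩
    P ℚ.* η               ∎
    where open ℚ.≤-Reasoning

  *-close : ∀ {A B η ε} p q r s → 0ℚ ℚ.< A → 0ℚ ℚ.< B → (A ℚ.+ B) ℚ.* η ≡ ε →
    ℚ.∣ p ∣ ℚ.≤ A → ℚ.∣ s ∣ ℚ.≤ B → ℚ.∣ p ℚ.- r ∣ ℚ.< η → ℚ.∣ q ℚ.- s ∣ ℚ.< η →
    ℚ.∣ p ℚ.* q ℚ.- r ℚ.* s ∣ ℚ.< ε
  *-close {A} {B} {η} {ε} p q r s 0<A 0<B eq p≤A s≤B pr qs = begin-strict
    ℚ.∣ p ℚ.* q ℚ.- r ℚ.* s ∣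
      ≡⟨ cong ℚ.∣_∣ (regroup p q r s) ⟩
    ℚ.∣ p ℚ.* (q ℚ.- s) ℚ.+ s ℚ.* (p ℚ.- r) ∣
      ≤⟨ ℚ.∣p+q∣≤∣p∣+∣q∣ (p ℚ.* (q ℚ.- s)) (s ℚ.* (p ℚ.- r)) ⟩
    ℚ.∣ p ℚ.* (q ℚ.- s) ∣ ℚ.+ ℚ.∣ s ℚ.* (p ℚ.- r) ∣
      <⟨ ℚ.+-mono-< (∣p*q∣< p (q ℚ.- s) 0<A p≤A qs) (∣p*q∣< s (p ℚ.- r) 0<B s≤B pr) ⟩
    A ℚ.* η ℚ.+ B ℚ.* η
      ≡⟨ ℚ.*-distribʳ-+ η A B ⟨
    (A ℚ.+ B) ℚ.* η
      ≡⟨ eq ⟩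
    ε ∎
    where
    open ℚ.≤-Reasoning
    regroup : ∀ p q r s → p ℚ.* q ℚ.- r ℚ.* s ≡ p ℚ.* (q ℚ.- s) ℚ.+ s ℚ.* (p ℚ.- r)
    regroup = solve 4 (λ p q r s → p :* q :- r :* s := p :* (q :- s) :+ s :* (p :- r)) refl
      where open +-*-Solver

  *-cauchy : ∀ {a b} → IsCauchy a → IsCauchy b → IsCauchy (λ n → a n ℚ.* b n)
  *-cauchy {a} {b} ca cb ε 0<ε =
    let A , 0<A , K , a≤A = bounded ca
        B , 0<B , L , b≤B = bounded cb
        η , 0<η , eq      = divide (A ℚ.+ B) ε (ℚ.+-mono-< 0<A 0<B) 0<ε
        M , closeᵃ        = ca η 0<η
        N , closeᵇ        = cb η 0<η
    in (K ℕ.⊔ L) ℕ.⊔ (M ℕ.⊔ N) , λ m n ≤m ≤n →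
      let KL≤m = ℕ.m⊔n≤o⇒m≤o (K ℕ.⊔ L) (M ℕ.⊔ N) ≤m
          KL≤n = ℕ.m⊔n≤o⇒m≤o (K ℕ.⊔ L) (M ℕ.⊔ N) ≤n
          MN≤m = ℕ.m⊔n≤o⇒n≤o (K ℕ.⊔ L) (M ℕ.⊔ N) ≤m
          MN≤n = ℕ.m⊔n≤o⇒n≤o (K ℕ.⊔ L) (M ℕ.⊔ N) ≤n
      in *-close (a m) (b m) (a n) (b n) 0<A 0<B eq
           (a≤A m (ℕ.m⊔n≤o⇒m≤o K L KL≤m))
           (b≤B n (ℕ.m⊔n≤o⇒n≤o K L KL≤n))
           (closeᵃ m n (ℕ.m⊔n≤o⇒m≤o M N MN≤m) (ℕ.m⊔n≤o⇒m≤o M N MN≤n))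
           (closeᵇ m n (ℕ.m⊔n≤o⇒n≤o M N MN≤m) (ℕ.m⊔n≤o⇒n≤o M N MN≤n))

fromℚ : ℚ → ℝ
fromℚ q = mkℝ (λ _ → q) λ ε 0<ε → 0 , λ _ _ _ _ →
  subst (ℚ._< ε) (sym (cong ℚ.∣_∣ (ℚ.+-inverseʳ q))) 0<ε

_+ᴿ_ : ℝ → ℝ → ℝ
x +ᴿ y = mkℝ (λ n → seq x n ℚ.+ seq y n) (+-cauchy {seq x} {seq y} (cauchy x) (cauchy y))

_*ᴿ_ : ℝ → ℝ → ℝ
x *ᴿ y = mkℝ (λ n → seq x n ℚ.* seq y n) (*-cauchy {seq x} {seq y} (cauchy x) (cauchy y))

-ᴿ_ : ℝ → ℝ
-ᴿ x = mkℝ (λ n → ℚ.- seq x n) (neg-cauchy {seq x} (cauchy x))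

_-ᴿ_ : ℝ → ℝ → ℝ
x -ᴿ y = x +ᴿ (-ᴿ y)

∣_∣ᴿ : ℝ → ℝ
∣ x ∣ᴿ = mkℝ (λ n → ℚ.∣ seq x n ∣) (∣∣-cauchy {seq x} (cauchy x))

⅓ : ℝ
⅓ = fromℚ (+ 1 ℚ./ 3)

-- It is enough to let ε range over ℚ, since ℚ is dense in ℝ.
ConvergesTo : (ℕ → ℝ) → ℝ → Set
ConvergesTo a x = ∀ ε → 0ℚ ℚ.< ε → ∃ λ N → ∀ n → N ℕ.≤ n →
  ∣ a n -ᴿ x ∣ᴿ <ᴿ fromℚ ε

{-# OPTIONS --safe #-}

-- Let M = z(1 + M + M²) count Motzkin trees, and let B k count the trees whose
-- root is balanced of rank k, so B 0 = z and B (k+1) = z (B k + (B k)²). A tree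
-- with a marked vertex is a tree planted in a context, and contexts are counted
-- by P = 1/(1 - z - 2zM). So balanced vertices of rank k are counted by B k · P,
-- and all vertices by V = M · P. Since P = 1 + zP + 2zV and V = zM′, the
-- coefficients satisfy
--   p(n+1) = p(n) + 2 v(n),   (n+2) v(n+1) = (n+1) (2 p(n) + v(n)),
-- from which v(n)/p(n) → 1 and p(n+1)/p(n) → 3 with error O(1/n). If x(n)/p(n) → c
-- then multiplying X by z changes the limit to c/3; hence, by induction on k,
-- multiplying by B k changes it to b k · c, with b 0 = 1/3 and
-- b (k+1) = (b k + (b k)²)/3.
module Submission where

open import Defs
open import Data.Nat as ℕ using (ℕ; zero; suc; _+_; _*_; _≤_; z≤n; s≤s)
import Data.Nat.Properties as ℕ
open import Data.Nat.Tactic.RingSolver using (solve-∀)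
open import Data.List using (List; []; _∷_; _++_; map; filter; length; cartesianProduct; cartesianProductWith)
open import Data.List.Properties using (filter-++; length-++; map-++; map-∘; map-cong; filter-accept; filter-reject)
open import Data.List.Membership.Propositional using (_∈_)
open import Data.List.Membership.Propositional.Properties using (∈-filter⁺; ∈-filter⁻)
open import Data.List.Membership.Propositional.Properties.WithK using (unique∧set⇒bag)
open import Data.List.Relation.Binary.BagAndSetEquality using (∼bag⇒↭)
open import Data.List.Relation.Binary.Permutation.Propositional using (_↭_)
open import Data.List.Relation.Binary.Permutation.Propositional.Properties using (map⁺)
open import Data.List.Relation.Unary.Any using (here; there)
import Data.List.Relation.Unary.Unique.Propositional.Properties as Unique
open import Data.Nat.ListAction using (sum)
open import Data.Nat.ListAction.Properties using (sum-↭)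
open import Data.Product using (Σ; ∃; _×_; _,_; proj₁; proj₂; uncurry)
open import Function using (_∘_; mk⇔; it)
open import Relation.Binary.PropositionalEquality
  using (_≡_; _≢_; _≗_; refl; sym; trans; cong; cong₂; subst; module ≡-Reasoning)
open import Data.Bool using (if_then_else_; true; false)
open import Data.List.NonEmpty as List⁺ using (toList; foldr₁; _⁺++⁺_)
open import Data.List.Relation.Unary.All as All using (All; []; _∷_)
import Data.List.Relation.Unary.All.Properties as All
open import Data.List.Relation.Unary.AllPairs using (AllPairs; []; _∷_)
open import Data.Integer as ℤ using (-[1+_]) renaming (+_ to pos)
import Data.Integer.Properties as ℤ
open import Data.Rational as ℚ using (ℚ; mkℚ; 0ℚ; 1ℚ; ½; toℚᵘ)
import Data.Rational.Properties as ℚ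
open import Data.Rational.Unnormalised as ℚᵘ using (mkℚᵘ; *≡*; *≤*; _≃_)
import Data.Rational.Unnormalised.Properties as ℚᵘ
open import Data.Rational.Solver using (module +-*-Solver)
open import Relation.Nullary using (Dec; yes; no; does; ¬_; contradiction)

-- Formal power series with natural coefficients.

infixl 6 _⊕_
infixl 7 _⊛_

Series : Set
Series = ℕ → ℕ

_⊕_ : Series → Series → Series
(f ⊕ g) n = f n + g n

-- Cauchy product, peeling off the constant term of the left factor; this avoids sums over index
-- pairs and truncated subtraction.
_⊛_ : Series → Series → Series
(f ⊛ g) zero    = f 0 * g 0
(f ⊛ g) (suc n) = f 0 * g (suc n) + (f ∘ suc ⊛ g) n

shift : Series → Series
shift f zero    = 0
shift f (suc n) = f n

-- Coefficient n of a product reads only coefficients up to n. This locality serves the truncated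
-- enumerations of trees and the induction in `gen-total`.
⊛-cong-≤ : ∀ {f f′ g g′} n → (∀ {i} → i ≤ n → f i ≡ f′ i) → (∀ {i} → i ≤ n → g i ≡ g′ i) →
  (f ⊛ g) n ≡ (f′ ⊛ g′) n
⊛-cong-≤ zero    p q = cong₂ _*_ (p z≤n) (q z≤n)
⊛-cong-≤ (suc n) p q = cong₂ _+_ (cong₂ _*_ (p z≤n) (q ℕ.≤-refl))
  (⊛-cong-≤ n (p ∘ s≤s) (q ∘ ℕ.m≤n⇒m≤1+n))

⊛-cong : ∀ {f f′ g g′} → f ≗ f′ → g ≗ g′ → f ⊛ g ≗ f′ ⊛ g′
⊛-cong p q n = ⊛-cong-≤ n (λ _ → p _) (λ _ → q _)

⊛-distribʳ : ∀ f g h → (f ⊕ g) ⊛ h ≗ f ⊛ h ⊕ g ⊛ h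
⊛-distribʳ f g h zero    = ℕ.*-distribʳ-+ (h 0) (f 0) (g 0)
⊛-distribʳ f g h (suc n)
  rewrite ⊛-distribʳ (f ∘ suc) (g ∘ suc) h n =
  lemma (f 0) (g 0) (h (suc n)) ((f ∘ suc ⊛ h) n) ((g ∘ suc ⊛ h) n)
  where
  lemma : ∀ a b c x y → (a + b) * c + (x + y) ≡ a * c + x + (b * c + y)
  lemma = solve-∀

⊛-zeroˡ : ∀ f → (λ _ → 0) ⊛ f ≗ λ _ → 0
⊛-zeroˡ f zero    = refl
⊛-zeroˡ f (suc n) = ⊛-zeroˡ f n

⊛-scaleˡ : ∀ a f g → (λ n → a * f n) ⊛ g ≗ λ n → a * (f ⊛ g) n
⊛-scaleˡ a f g zero    = ℕ.*-assoc a (f 0) (g 0)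
⊛-scaleˡ a f g (suc n)
  rewrite ⊛-scaleˡ a (f ∘ suc) g n =
  lemma a (f 0) (g (suc n)) ((f ∘ suc ⊛ g) n)
  where
  lemma : ∀ a b c x → a * b * c + a * x ≡ a * (b * c + x)
  lemma = solve-∀

-- The mirror image of the defining equation, peeling off the constant term of the right factor;
-- commutativity rests on it.
⊛-sucʳ : ∀ f g n → (f ⊛ g) (suc n) ≡ f (suc n) * g 0 + (f ⊛ g ∘ suc) n
⊛-sucʳ f g zero    = ℕ.+-comm (f 0 * g 1) (f 1 * g 0)
⊛-sucʳ f g (suc n)
  rewrite ⊛-sucʳ (f ∘ suc) g n =
  lemma (f 0 * g (suc (suc n))) (f (suc (suc n)) * g 0) ((f ∘ suc ⊛ g ∘ suc) n)
  where
  lemma : ∀ a b c → a + (b + c) ≡ b + (a + c)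
  lemma = solve-∀

⊛-comm : ∀ f g → f ⊛ g ≗ g ⊛ f
⊛-comm f g zero    = ℕ.*-comm (f 0) (g 0)
⊛-comm f g (suc n) = begin
  f 0 * g (suc n) + (f ∘ suc ⊛ g) n  ≡⟨ cong₂ _+_ (ℕ.*-comm (f 0) (g (suc n))) (⊛-comm (f ∘ suc) g n) ⟩
  g (suc n) * f 0 + (g ⊛ f ∘ suc) n  ≡⟨ ⊛-sucʳ g f n ⟨
  (g ⊛ f) (suc n)                    ∎
  where open ≡-Reasoning

⊛-assoc : ∀ f g h → (f ⊛ g) ⊛ h ≗ f ⊛ (g ⊛ h)
⊛-assoc f g h zero    = ℕ.*-assoc (f 0) (g 0) (h 0)
⊛-assoc f g h (suc n) = begin
  -- By definition the tail of `f ⊛ g` is `f 0` times the tail of `g`, plus `f ∘ suc ⊛ g`.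
  f 0 * g 0 * h (suc n) + (((λ i → f 0 * g (suc i)) ⊕ f ∘ suc ⊛ g) ⊛ h) n
    ≡⟨ cong (f 0 * g 0 * h (suc n) +_) (⊛-distribʳ (λ i → f 0 * g (suc i)) (f ∘ suc ⊛ g) h n) ⟩
  f 0 * g 0 * h (suc n) + (((λ i → f 0 * g (suc i)) ⊛ h) n + (f ∘ suc ⊛ g ⊛ h) n)
    ≡⟨ cong (f 0 * g 0 * h (suc n) +_)
         (cong₂ _+_ (⊛-scaleˡ (f 0) (g ∘ suc) h n) (⊛-assoc (f ∘ suc) g h n)) ⟩
  f 0 * g 0 * h (suc n) + (f 0 * (g ∘ suc ⊛ h) n + (f ∘ suc ⊛ (g ⊛ h)) n)
    ≡⟨ lemma (f 0) (g 0) (h (suc n)) ((g ∘ suc ⊛ h) n) ((f ∘ suc ⊛ (g ⊛ h)) n) ⟩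
  f 0 * (g 0 * h (suc n) + (g ∘ suc ⊛ h) n) + (f ∘ suc ⊛ (g ⊛ h)) n ∎
  where
  open ≡-Reasoning
  lemma : ∀ a b c x y → a * b * c + (a * x + y) ≡ a * (b * c + x) + y
  lemma = solve-∀

⊛-distribˡ : ∀ f g h → f ⊛ (g ⊕ h) ≗ f ⊛ g ⊕ f ⊛ h
⊛-distribˡ f g h n = begin
  (f ⊛ (g ⊕ h)) n          ≡⟨ ⊛-comm f (g ⊕ h) n ⟩
  ((g ⊕ h) ⊛ f) n          ≡⟨ ⊛-distribʳ g h f n ⟩
  (g ⊛ f) n + (h ⊛ f) n    ≡⟨ cong₂ _+_ (⊛-comm g f n) (⊛-comm h f n) ⟩
  (f ⊛ g) n + (f ⊛ h) n    ∎
  where open ≡-Reasoning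

⊛-shiftˡ : ∀ f g → shift f ⊛ g ≗ shift (f ⊛ g)
⊛-shiftˡ f g zero    = refl
⊛-shiftˡ f g (suc n) = refl

-- Monomials and generating polynomials of finite lists.

-- The monomial a zˢ, built with `shift` so that a factor z is removed by computation.
point : ℕ → ℕ → Series
point zero    a zero    = a
point zero    a (suc n) = 0
point (suc s) a         = shift (point s a)

point-diagonal : ∀ s a → point s a s ≡ a
point-diagonal zero    a = refl
point-diagonal (suc s) a = point-diagonal s a

point-off-diagonal : ∀ {s n} a → s ≢ n → point s a n ≡ 0
point-off-diagonal {zero}  {zero}  a s≢n = contradiction refl s≢n
point-off-diagonal {zero}  {suc n} a s≢n = refl
point-off-diagonal {suc s} {zero}  a s≢n = refl
point-off-diagonal {suc s} {suc n} a s≢n = point-off-diagonal {s} a (s≢n ∘ cong suc)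

point-+ : ∀ s a b → point s (a + b) ≗ point s a ⊕ point s b
point-+ zero    a b zero    = refl
point-+ zero    a b (suc n) = refl
point-+ (suc s) a b zero    = refl
point-+ (suc s) a b (suc n) = point-+ s a b n

point-zero-⊛ : ∀ a f → point 0 a ⊛ f ≗ λ n → a * f n
point-zero-⊛ a f zero    = refl
point-zero-⊛ a f (suc n) = trans (cong (a * f (suc n) +_) (⊛-zeroˡ f n)) (ℕ.+-identityʳ _)

point-* : ∀ s t a b → point (s + t) (a * b) ≗ point s a ⊛ point t b
point-* (suc s) t       a b zero    = refl
point-* (suc s) t       a b (suc n) = point-* s t a b n
point-* zero    t       a b n       = trans (scale t n) (sym (point-zero-⊛ a (point t b) n))
  where
  scale : ∀ t n → point t (a * b) n ≡ a * point t b n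
  scale zero    zero    = refl
  scale zero    (suc n) = sym (ℕ.*-zeroʳ a)
  scale (suc t) zero    = sym (ℕ.*-zeroʳ a)
  scale (suc t) (suc n) = scale t n

module _ {A : Set} where

  -- The generating polynomial of a list: `s` gives the exponent and `f` the coefficient. In this
  -- form pairs turn into products.
  weight : (A → ℕ) → (A → ℕ) → List A → Series
  weight s f []       n = 0
  weight s f (x ∷ xs) n = point (s x) (f x) n + weight s f xs n

  weight-cong : ∀ s {f g} → f ≗ g → ∀ xs → weight s f xs ≗ weight s g xs
  weight-cong s p []       n = refl
  weight-cong s p (x ∷ xs) n = cong₂ _+_ (cong (λ a → point (s x) a n) (p x)) (weight-cong s p xs n)

  weight-++ : ∀ s f xs ys → weight s f (xs ++ ys) ≗ weight s f xs ⊕ weight s f ys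
  weight-++ s f []       ys n = refl
  weight-++ s f (x ∷ xs) ys n =
    trans (cong (point (s x) (f x) n +_) (weight-++ s f xs ys n))
          (sym (ℕ.+-assoc (point (s x) (f x) n) (weight s f xs n) (weight s f ys n)))

  weight-+ : ∀ s f g xs → weight s (λ x → f x + g x) xs ≗ weight s f xs ⊕ weight s g xs
  weight-+ s f g []       n = refl
  weight-+ s f g (x ∷ xs) n
    rewrite point-+ (s x) (f x) (g x) n | weight-+ s f g xs n =
    lemma (point (s x) (f x) n) (point (s x) (g x) n) (weight s f xs n) (weight s g xs n)
    where
    lemma : ∀ a b c d → a + b + (c + d) ≡ a + c + (b + d)
    lemma = solve-∀

  weight-suc : ∀ s f xs → weight (suc ∘ s) f xs ≗ shift (weight s f xs)
  weight-suc s f []       zero    = refl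
  weight-suc s f []       (suc n) = refl
  weight-suc s f (x ∷ xs) zero    = weight-suc s f xs zero
  weight-suc s f (x ∷ xs) (suc n) = cong (point (s x) (f x) n +_) (weight-suc s f xs (suc n))

  -- Links the polynomial to the filtered lists by which `trees` is defined.
  weight≡sum : ∀ s f xs n → weight s f xs n ≡ sum (map f (filter (λ x → s x ℕ.≟ n) xs))
  weight≡sum s f []       n = refl
  weight≡sum s f (x ∷ xs) n with s x ℕ.≟ n
  ... | yes refl rewrite filter-accept (λ y → s y ℕ.≟ s x) {x} {xs} refl =
    cong₂ _+_ (point-diagonal (s x) (f x)) (weight≡sum s f xs (s x))
  ... | no  sx≢n rewrite filter-reject (λ y → s y ℕ.≟ n) {x} {xs} sx≢n =
    cong₂ _+_ (point-off-diagonal {s x} (f x) sx≢n) (weight≡sum s f xs n)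

weight-map : ∀ {A B : Set} s f (j : A → B) xs → weight s f (map j xs) ≗ weight (s ∘ j) (f ∘ j) xs
weight-map s f j []       n = refl
weight-map s f j (x ∷ xs) n = cong (point (s (j x)) (f (j x)) n +_) (weight-map s f j xs n)

-- The product rule: on pairs the sizes add and the weights multiply, so each monomial of the left
-- list multiplies the whole right polynomial.
weight-× : ∀ {A B : Set} s t (f : A → ℕ) (g : B → ℕ) xs ys →
  weight (λ (x , y) → s x + t y) (λ (x , y) → f x * g y) (cartesianProduct xs ys)
    ≗ weight s f xs ⊛ weight t g ys
weight-× s t f g []       ys n = sym (⊛-zeroˡ (weight t g ys) n)
weight-× s t f g (x ∷ xs) ys n = begin
  weight st fg (map (x ,_) ys ++ cartesianProduct xs ys) n
    ≡⟨ weight-++ st fg (map (x ,_) ys) (cartesianProduct xs ys) n ⟩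
  weight st fg (map (x ,_) ys) n + weight st fg (cartesianProduct xs ys) n
    ≡⟨ cong₂ _+_ (trans (weight-map st fg (x ,_) ys n) (row ys n)) (weight-× s t f g xs ys n) ⟩
  (point (s x) (f x) ⊛ weight t g ys) n + (weight s f xs ⊛ weight t g ys) n
    ≡⟨ ⊛-distribʳ (point (s x) (f x)) (weight s f xs) (weight t g ys) n ⟨
  (weight s f (x ∷ xs) ⊛ weight t g ys) n ∎
  where
  open ≡-Reasoning
  st = λ (x , y) → s x + t y
  fg = λ (x , y) → f x * g y
  row : ∀ ys → weight (λ y → s x + t y) (λ y → f x * g y) ys ≗ point (s x) (f x) ⊛ weight t g ys
  row []       n = sym (trans (⊛-comm (point (s x) (f x)) _ n) (⊛-zeroˡ (point (s x) (f x)) n))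
  row (y ∷ ys) n = begin
    point (s x + t y) (f x * g y) n + weight (λ y → s x + t y) (λ y → f x * g y) ys n
      ≡⟨ cong₂ _+_ (point-* (s x) (t y) (f x) (g y) n) (row ys n) ⟩
    (point (s x) (f x) ⊛ point (t y) (g y)) n + (point (s x) (f x) ⊛ weight t g ys) n
      ≡⟨ ⊛-distribˡ (point (s x) (f x)) (point (t y) (g y)) (weight t g ys) n ⟨
    (point (s x) (f x) ⊛ weight t g (y ∷ ys)) n ∎

cartesianProductWith-map : ∀ {A B C : Set} (f : A → B → C) xs ys →
  cartesianProductWith f xs ys ≡ map (uncurry f) (cartesianProduct xs ys)
cartesianProductWith-map f []       ys = refl
cartesianProductWith-map f (x ∷ xs) ys = sym (begin
  map (uncurry f) (map (x ,_) ys ++ cartesianProduct xs ys)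
    ≡⟨ map-++ (uncurry f) (map (x ,_) ys) (cartesianProduct xs ys) ⟩
  map (uncurry f) (map (x ,_) ys) ++ map (uncurry f) (cartesianProduct xs ys)
    ≡⟨ cong₂ _++_ (map-∘ ys) (cartesianProductWith-map f xs ys) ⟨
  map (f x) ys ++ cartesianProductWith f xs ys ∎)
  where open ≡-Reasoning

-- Generating functions of weighted Motzkin trees.

gen : (Motzkin → ℕ) → Series
gen f n = sum (map f (trees n))

gen-cong : ∀ {f g} → f ≗ g → gen f ≗ gen g
gen-cong p n = cong sum (map-cong p (trees n))

-- Both lists are duplicate-free and have the same members, as a tree with n vertices has height
-- below n. Their order is not compared; a permutation suffices for sums.
trees-height : ∀ {n h} → n ≤ h → filter (λ t → size t ℕ.≟ n) (treesOfHeight< h) ↭ trees n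
trees-height {n} {h} n≤h = ∼bag⇒↭ (unique∧set⇒bag
  (Unique.filter⁺ (λ t → size t ℕ.≟ n) (treesOfHeight<-unique h))
  (trees-unique n)
  λ {t} → mk⇔
    (λ t∈ → ∈-trees⁺ t (proj₂ (∈-filter⁻ (λ t → size t ℕ.≟ n) {xs = treesOfHeight< h} t∈)))
    (λ t∈ → let size≡n = ∈-trees⁻ t∈ in
      ∈-filter⁺ (λ t → size t ℕ.≟ n)
        (∈-treesOfHeight< t (ℕ.≤-trans (ℕ.≤-reflexive size≡n) n≤h)) size≡n))

weight-trees : ∀ f {n h} → n ≤ h → weight size f (treesOfHeight< h) n ≡ gen f n
weight-trees f {n} {h} n≤h = trans (weight≡sum size f (treesOfHeight< h) n)
  (sum-↭ (map⁺ f (trees-height n≤h)))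

gen-+ : ∀ f g → gen (λ t → f t + g t) ≗ gen f ⊕ gen g
gen-+ f g n = begin
  gen (λ t → f t + g t) n                        ≡⟨ weight-trees (λ t → f t + g t) {n} ℕ.≤-refl ⟨
  weight size (λ t → f t + g t) (treesOfHeight< n) n  ≡⟨ weight-+ size f g (treesOfHeight< n) n ⟩
  weight size f (treesOfHeight< n) n + weight size g (treesOfHeight< n) n
    ≡⟨ cong₂ _+_ (weight-trees f {n} ℕ.≤-refl) (weight-trees g {n} ℕ.≤-refl) ⟩
  gen f n + gen g n ∎
  where open ≡-Reasoning

size² : Motzkin × Motzkin → ℕ
size² (t , u) = size t + size u

pairsBelow : ℕ → List (Motzkin × Motzkin)
pairsBelow n = cartesianProduct (treesOfHeight< n) (treesOfHeight< n)

-- Cases on the root, whose vertex accounts for the shift in the index. The binary term stays a sum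
-- over pairs because `f` of a binary tree need not split into a product.
gen-suc : ∀ f n → gen f (suc n) ≡
  point 0 (f leaf) n + (gen (f ∘ unary) n + weight size² (f ∘ uncurry binary) (pairsBelow n) n)
gen-suc f n = begin
  gen f (suc n)
    ≡⟨ weight-trees f {suc n} ℕ.≤-refl ⟨
  point 0 (f leaf) n + weight size f (map unary ts ++ cartesianProductWith binary ts ts) (suc n)
    ≡⟨ cong (point 0 (f leaf) n +_) (weight-++ size f (map unary ts) _ (suc n)) ⟩
  point 0 (f leaf) n + (weight size f (map unary ts) (suc n) +
                        weight size f (cartesianProductWith binary ts ts) (suc n))
    ≡⟨ cong (point 0 (f leaf) n +_) (cong₂ _+_ unaries binaries) ⟩
  point 0 (f leaf) n + (gen (f ∘ unary) n + weight size² (f ∘ uncurry binary) (pairsBelow n) n) ∎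
  where
  open ≡-Reasoning
  ts = treesOfHeight< n
  unaries : weight size f (map unary ts) (suc n) ≡ gen (f ∘ unary) n
  unaries = begin
    weight size f (map unary ts) (suc n)        ≡⟨ weight-map size f unary ts (suc n) ⟩
    weight (suc ∘ size) (f ∘ unary) ts (suc n)  ≡⟨ weight-suc size (f ∘ unary) ts (suc n) ⟩
    weight size (f ∘ unary) ts n                ≡⟨ weight-trees (f ∘ unary) {n} ℕ.≤-refl ⟩
    gen (f ∘ unary) n                           ∎
  binaries : weight size f (cartesianProductWith binary ts ts) (suc n) ≡
    weight size² (f ∘ uncurry binary) (pairsBelow n) n
  binaries = begin
    weight size f (cartesianProductWith binary ts ts) (suc n)
      ≡⟨ cong (λ us → weight size f us (suc n)) (cartesianProductWith-map binary ts ts) ⟩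
    weight size f (map (uncurry binary) (pairsBelow n)) (suc n)
      ≡⟨ weight-map size f (uncurry binary) (pairsBelow n) (suc n) ⟩
    weight (suc ∘ size²) (f ∘ uncurry binary) (pairsBelow n) (suc n)
      ≡⟨ weight-suc size² (f ∘ uncurry binary) (pairsBelow n) (suc n) ⟩
    weight size² (f ∘ uncurry binary) (pairsBelow n) n ∎

-- Cutting at height n loses nothing at index n, where only trees with at most n vertices enter the
-- product.
weight-pairsBelow : ∀ f g n →
  weight size² (λ (t , u) → f t * g u) (pairsBelow n) n ≡ (gen f ⊛ gen g) n
weight-pairsBelow f g n = trans
  (weight-× size size f g (treesOfHeight< n) (treesOfHeight< n) n)
  (⊛-cong-≤ n (weight-trees f) (weight-trees g))

-- Sums over all vertices of a tree.

-- Marking a vertex: `e` is evaluated at the subtree of every vertex. Weight 1 yields the size, and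
-- `rootBalanced k` the number of balanced vertices of rank k.
total : (Motzkin → ℕ) → Motzkin → ℕ
total e leaf         = e leaf
total e (unary t)    = e (unary t) + total e t
total e (binary t u) = e (binary t u) + (total e t + total e u)

motzkin : Series
motzkin = gen (λ _ → 1)

-- The marked vertex is the root, or lies below a unary root, or lies in one of two children while
-- the other child is an arbitrary tree: X = E + zX + 2zMX.
gen-total-suc : ∀ e n → gen (total e) (suc n) ≡
  gen e (suc n) + (gen (total e) n + 2 * (motzkin ⊛ gen (total e)) n)
gen-total-suc e n = begin
  gen (total e) (suc n)
    ≡⟨ gen-suc (total e) n ⟩
  l + (gen (λ t → e (unary t) + v t) n + weight size² (total e ∘ uncurry binary) ps n)
    ≡⟨ cong (l +_) (cong₂ _+_ (gen-+ (e ∘ unary) v n) binaries) ⟩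
  l + (gen (e ∘ unary) n + gen v n + (weight size² (e ∘ uncurry binary) ps n + 2 * (motzkin ⊛ gen v) n))
    ≡⟨ regroup l (gen (e ∘ unary) n) (gen v n) (weight size² (e ∘ uncurry binary) ps n) _ ⟩
  l + (gen (e ∘ unary) n + weight size² (e ∘ uncurry binary) ps n) + (gen v n + 2 * (motzkin ⊛ gen v) n)
    ≡⟨ cong (_+ (gen v n + 2 * (motzkin ⊛ gen v) n)) (gen-suc e n) ⟨
  gen e (suc n) + (gen v n + 2 * (motzkin ⊛ gen v) n) ∎
  where
  open ≡-Reasoning
  v = total e
  l = point 0 (e leaf) n
  ps = pairsBelow n
  regroup : ∀ a b c d x → a + (b + c + (d + x)) ≡ a + (b + d) + (c + x)
  regroup = solve-∀
  double : ∀ x → x + x ≡ 2 * x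
  double = solve-∀
  onPairs : (Motzkin → Motzkin → ℕ) → ℕ
  onPairs F = weight size² (uncurry F) ps n
  binaries : weight size² (v ∘ uncurry binary) ps n ≡
    weight size² (e ∘ uncurry binary) ps n + 2 * (motzkin ⊛ gen v) n
  binaries = begin
    onPairs (λ t u → e (binary t u) + (v t + v u))
      ≡⟨ weight-+ size² (e ∘ uncurry binary) (λ (t , u) → v t + v u) ps n ⟩
    onPairs (λ t u → e (binary t u)) + onPairs (λ t u → v t + v u)
      ≡⟨ cong (onPairs (λ t u → e (binary t u)) +_) (weight-+ size² (v ∘ proj₁) (v ∘ proj₂) ps n) ⟩
    onPairs (λ t u → e (binary t u)) + (onPairs (λ t u → v t) + onPairs (λ t u → v u))
      ≡⟨ cong (onPairs (λ t u → e (binary t u)) +_) (cong₂ _+_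
           -- A factor 1 for the unmarked child brings the summand into product form.
           (trans (weight-cong size² (λ (t , u) → sym (ℕ.*-identityʳ (v t))) ps n)
             (trans (weight-pairsBelow v (λ _ → 1) n) (⊛-comm (gen v) motzkin n)))
           (trans (weight-cong size² (λ (t , u) → sym (ℕ.*-identityˡ (v u))) ps n)
             (weight-pairsBelow (λ _ → 1) v n))) ⟩
    onPairs (λ t u → e (binary t u)) + ((motzkin ⊛ gen v) n + (motzkin ⊛ gen v) n)
      ≡⟨ cong (onPairs (λ t u → e (binary t u)) +_) (double ((motzkin ⊛ gen v) n)) ⟩
    onPairs (λ t u → e (binary t u)) + 2 * (motzkin ⊛ gen v) n ∎

-- Series of trees, vertices and contexts.

motzkin-suc : ∀ n → motzkin (suc n) ≡ point 0 1 n + (motzkin n + (motzkin ⊛ motzkin) n)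
motzkin-suc n = trans (gen-suc (λ _ → 1) n)
  (cong (λ a → point 0 1 n + (motzkin n + a)) (weight-pairsBelow (λ _ → 1) (λ _ → 1) n))

total-1 : total (λ _ → 1) ≗ size
total-1 leaf         = refl
total-1 (unary t)    = cong suc (total-1 t)
total-1 (binary t u) = cong suc (cong₂ _+_ (total-1 t) (total-1 u))

motzkin≡#trees : ∀ n → motzkin n ≡ #trees n
motzkin≡#trees n = ones (trees n)
  where
  ones : ∀ (ts : List Motzkin) → sum (map (λ _ → 1) ts) ≡ length ts
  ones []       = refl
  ones (_ ∷ ts) = cong suc (ones ts)

#vertices : Series
#vertices = gen size

-- Coefficient form of V = zM′: each tree counted in coefficient n has n vertices.
#vertices≡ : ∀ n → #vertices n ≡ n * #trees n
#vertices≡ n = go (trees n) ∈-trees⁻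
  where
  go : ∀ ts → (∀ {t} → t ∈ ts → size t ≡ n) → sum (map size ts) ≡ n * length ts
  go []       p = sym (ℕ.*-zeroʳ n)
  go (t ∷ ts) p = trans (cong₂ _+_ (p (here refl)) (go ts (p ∘ there)))
    (sym (ℕ.*-suc n (length ts)))

#vertices-suc : ∀ n → #vertices (suc n) ≡ motzkin (suc n) + (#vertices n + 2 * (motzkin ⊛ #vertices) n)
#vertices-suc n = begin
  #vertices (suc n)
    ≡⟨ gen-cong total-1 (suc n) ⟨
  gen (total (λ _ → 1)) (suc n)
    ≡⟨ gen-total-suc (λ _ → 1) n ⟩
  motzkin (suc n) + (gen (total (λ _ → 1)) n + 2 * (motzkin ⊛ gen (total (λ _ → 1))) n)
    ≡⟨ cong (motzkin (suc n) +_) (cong₂ _+_ (gen-cong total-1 n)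
         (cong (2 *_) (⊛-cong {motzkin} (λ _ → refl) (gen-cong total-1) n))) ⟩
  motzkin (suc n) + (#vertices n + 2 * (motzkin ⊛ #vertices) n) ∎
  where open ≡-Reasoning

-- The central trinomial coefficients, P = 1 / (1 - z - 2zM): trees with one
-- marked place in which a subtree is to be planted.
trinomial : Series
trinomial zero    = 1
trinomial (suc n) = trinomial n + 2 * #vertices n

-- The equation P = 1 + zP + 2zV, multiplied by `f`.
⊛-trinomial-suc : ∀ f n → (f ⊛ trinomial) (suc n) ≡
  f (suc n) + ((f ⊛ trinomial) n + 2 * (f ⊛ #vertices) n)
⊛-trinomial-suc f n = begin
  (f ⊛ trinomial) (suc n)
    ≡⟨ ⊛-sucʳ f trinomial n ⟩
  f (suc n) * 1 + (f ⊛ (trinomial ⊕ (λ i → 2 * #vertices i))) n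
    ≡⟨ cong₂ _+_ (ℕ.*-identityʳ (f (suc n))) (⊛-distribˡ f trinomial (λ i → 2 * #vertices i) n) ⟩
  f (suc n) + ((f ⊛ trinomial) n + (f ⊛ (λ i → 2 * #vertices i)) n)
    ≡⟨ cong (λ a → f (suc n) + ((f ⊛ trinomial) n + a)) (trans (⊛-comm f (λ i → 2 * #vertices i) n)
         (trans (⊛-scaleˡ 2 #vertices f n) (cong (2 *_) (⊛-comm #vertices f n)))) ⟩
  f (suc n) + ((f ⊛ trinomial) n + 2 * (f ⊛ #vertices) n) ∎
  where open ≡-Reasoning

-- Both sides solve X = M + zX + 2zMV with the same series V in the last term, so the induction only
-- has to treat zX.
#vertices≗ : #vertices ≗ motzkin ⊛ trinomial
#vertices≗ zero    = refl
#vertices≗ (suc n) = begin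
  #vertices (suc n)
    ≡⟨ #vertices-suc n ⟩
  motzkin (suc n) + (#vertices n + 2 * (motzkin ⊛ #vertices) n)
    ≡⟨ cong (λ a → motzkin (suc n) + (a + 2 * (motzkin ⊛ #vertices) n)) (#vertices≗ n) ⟩
  motzkin (suc n) + ((motzkin ⊛ trinomial) n + 2 * (motzkin ⊛ #vertices) n)
    ≡⟨ ⊛-trinomial-suc motzkin n ⟨
  (motzkin ⊛ trinomial) (suc n) ∎
  where open ≡-Reasoning

-- Both sides solve X = gen e + z X + 2 z M X, which determines X.
gen-total : ∀ e → gen (total e) ≗ gen e ⊛ trinomial
gen-total e n = agree n ℕ.≤-refl
  where
  open ≡-Reasoning
  -- The convolution at i involves all coefficients up to i, so the induction hypothesis must cover
  -- every smaller index.
  agree : ∀ n {i} → i ≤ n → gen (total e) i ≡ (gen e ⊛ trinomial) i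
  agree n       z≤n             = refl
  agree (suc n) (s≤s {i} i≤n) = begin
    gen (total e) (suc i)
      ≡⟨ gen-total-suc e i ⟩
    gen e (suc i) + (gen (total e) i + 2 * (motzkin ⊛ gen (total e)) i)
      ≡⟨ cong (gen e (suc i) +_) (cong₂ _+_ (agree n i≤n) (cong (2 *_)
           (⊛-cong-≤ i (λ _ → refl) (λ j≤i → agree n (ℕ.≤-trans j≤i i≤n))))) ⟩
    gen e (suc i) + ((gen e ⊛ trinomial) i + 2 * (motzkin ⊛ (gen e ⊛ trinomial)) i)
      ≡⟨ cong (λ a → gen e (suc i) + ((gen e ⊛ trinomial) i + 2 * a)) swap ⟩
    gen e (suc i) + ((gen e ⊛ trinomial) i + 2 * (gen e ⊛ #vertices) i)
      ≡⟨ ⊛-trinomial-suc (gen e) i ⟨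
    (gen e ⊛ trinomial) (suc i) ∎
    where
    -- M is moved past E so that it meets P, and MP is V.
    swap : (motzkin ⊛ (gen e ⊛ trinomial)) i ≡ (gen e ⊛ #vertices) i
    swap = begin
      (motzkin ⊛ (gen e ⊛ trinomial)) i  ≡⟨ ⊛-assoc motzkin (gen e) trinomial i ⟨
      (motzkin ⊛ gen e ⊛ trinomial) i    ≡⟨ ⊛-cong {g = trinomial} (⊛-comm motzkin (gen e)) (λ _ → refl) i ⟩
      (gen e ⊛ motzkin ⊛ trinomial) i    ≡⟨ ⊛-assoc (gen e) motzkin trinomial i ⟩
      (gen e ⊛ (motzkin ⊛ trinomial)) i  ≡⟨ ⊛-cong {gen e} (λ _ → refl) #vertices≗ i ⟨
      (gen e ⊛ #vertices) i              ∎

-- Recurrences and growth of the coefficients.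

-- The equation M = z + zM + zM² multiplied by P, with MP read as V: V = zP + zV + zMV.
#vertices-suc-trinomial : ∀ n →
  #vertices (suc n) ≡ trinomial n + (#vertices n + (motzkin ⊛ #vertices) n)
#vertices-suc-trinomial n = begin
  #vertices (suc n)
    ≡⟨ #vertices≗ (suc n) ⟩
  -- The first term of the product vanishes by computation, since `motzkin 0` is 0.
  (motzkin ∘ suc ⊛ trinomial) n
    ≡⟨ ⊛-cong {g = trinomial} motzkin-suc (λ _ → refl) n ⟩
  ((point 0 1 ⊕ (motzkin ⊕ motzkin ⊛ motzkin)) ⊛ trinomial) n
    ≡⟨ ⊛-distribʳ (point 0 1) (motzkin ⊕ motzkin ⊛ motzkin) trinomial n ⟩
  (point 0 1 ⊛ trinomial) n + ((motzkin ⊕ motzkin ⊛ motzkin) ⊛ trinomial) n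
    ≡⟨ cong₂ _+_ (trans (point-zero-⊛ 1 trinomial n) (ℕ.*-identityˡ (trinomial n)))
         (⊛-distribʳ motzkin (motzkin ⊛ motzkin) trinomial n) ⟩
  trinomial n + ((motzkin ⊛ trinomial) n + (motzkin ⊛ motzkin ⊛ trinomial) n)
    ≡⟨ cong (trinomial n +_) (cong₂ _+_ (sym (#vertices≗ n))
         (trans (⊛-assoc motzkin motzkin trinomial n)
                (sym (⊛-cong {motzkin} (λ _ → refl) #vertices≗ n)))) ⟩
  trinomial n + (#vertices n + (motzkin ⊛ #vertices) n) ∎
  where open ≡-Reasoning

-- Eliminating M² P between the two expansions of M P, through M = z + zM + zM²
-- and through P = 1 + zP + 2zMP.
#vertices+motzkin : ∀ n →
  #vertices (suc n) + motzkin (suc n) ≡ 2 * trinomial n + #vertices n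
#vertices+motzkin n = ℕ.+-cancelˡ-≡ (#vertices n + 2 * (motzkin ⊛ #vertices) n) _ _ (begin
  (v + 2 * d) + (#vertices (suc n) + motzkin (suc n))
    ≡⟨ regroup₁ (v + 2 * d) (#vertices (suc n)) (motzkin (suc n)) ⟩
  #vertices (suc n) + (motzkin (suc n) + (v + 2 * d))
    ≡⟨ cong (#vertices (suc n) +_) (#vertices-suc n) ⟨
  #vertices (suc n) + #vertices (suc n)
    ≡⟨ cong₂ _+_ (#vertices-suc-trinomial n) (#vertices-suc-trinomial n) ⟩
  (p + (v + d)) + (p + (v + d))
    ≡⟨ regroup₂ p v d ⟩
  (v + 2 * d) + (2 * p + v) ∎)
  where
  open ≡-Reasoning
  v = #vertices n
  d = (motzkin ⊛ #vertices) n
  p = trinomial n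
  regroup₁ : ∀ a b c → a + (b + c) ≡ b + (c + a)
  regroup₁ = solve-∀
  regroup₂ : ∀ p v d → (p + (v + d)) + (p + (v + d)) ≡ (v + 2 * d) + (2 * p + v)
  regroup₂ = solve-∀

-- Multiplication by 1 + n turns the term `motzkin (suc n)` of `#vertices+motzkin` into
-- `#vertices (suc n)`, as all trees of that size have 1 + n vertices; only two sequences remain.
#vertices-rec : ∀ n → (2 + n) * #vertices (suc n) ≡ (1 + n) * (2 * trinomial n + #vertices n)
#vertices-rec n = begin
  (2 + n) * #vertices (suc n)
    ≡⟨ cong (_+ (1 + n) * #vertices (suc n)) (trans (#vertices≡ (suc n)) (cong (suc n *_) (sym (motzkin≡#trees (suc n))))) ⟩
  (1 + n) * motzkin (suc n) + (1 + n) * #vertices (suc n)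
    ≡⟨ trans (ℕ.+-comm ((1 + n) * motzkin (suc n)) _)
         (sym (ℕ.*-distribˡ-+ (1 + n) (#vertices (suc n)) (motzkin (suc n)))) ⟩
  (1 + n) * (#vertices (suc n) + motzkin (suc n))
    ≡⟨ cong ((1 + n) *_) (#vertices+motzkin n) ⟩
  (1 + n) * (2 * trinomial n + #vertices n) ∎
  where open ≡-Reasoning

-- The two bounds prove each other; they say that trinomial (1 + n) / trinomial n
-- lies between 3 - 2/(1 + n) and 3.
trinomial-bounds : ∀ n →
  #vertices n ≤ trinomial n × n * trinomial n ≤ (1 + n) * #vertices n
trinomial-bounds zero    = z≤n , z≤n
trinomial-bounds (suc n) with trinomial-bounds n
... | v≤p , np≤[1+n]v = ℕ.*-cancelˡ-≤ (2 + n) upper , lower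
  where
  open ℕ.≤-Reasoning
  v = #vertices n
  p = trinomial n
  upper : (2 + n) * #vertices (suc n) ≤ (2 + n) * trinomial (suc n)
  upper = begin
    (2 + n) * #vertices (suc n)                ≡⟨ #vertices-rec n ⟩
    (1 + n) * (2 * p + v)                      ≡⟨ expand n p v ⟩
    n * p + ((2 + n) * p + (1 + n) * v)        ≤⟨ ℕ.+-monoˡ-≤ ((2 + n) * p + (1 + n) * v) np≤[1+n]v ⟩
    -- The slack 2 * v completes the coefficient of v to 2 * (2 + n).
    (1 + n) * v + ((2 + n) * p + (1 + n) * v)  ≤⟨ ℕ.m≤n+m _ (2 * v) ⟩
    2 * v + ((1 + n) * v + ((2 + n) * p + (1 + n) * v)) ≡⟨ collect n p v ⟩
    (2 + n) * (p + 2 * v)                      ∎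
    where
    expand : ∀ n p v → (1 + n) * (2 * p + v) ≡ n * p + ((2 + n) * p + (1 + n) * v)
    expand = solve-∀
    collect : ∀ n p v → 2 * v + ((1 + n) * v + ((2 + n) * p + (1 + n) * v)) ≡ (2 + n) * (p + 2 * v)
    collect = solve-∀
  lower : (1 + n) * trinomial (suc n) ≤ (2 + n) * #vertices (suc n)
  lower = begin
    (1 + n) * (p + 2 * v)        ≡⟨ cong ((1 + n) *_) (split p v) ⟩
    (1 + n) * (v + (p + v))      ≤⟨ ℕ.*-monoʳ-≤ (1 + n) (ℕ.+-monoˡ-≤ (p + v) v≤p) ⟩
    (1 + n) * (p + (p + v))      ≡⟨ cong ((1 + n) *_) (merge p v) ⟩
    (1 + n) * (2 * p + v)        ≡⟨ #vertices-rec n ⟨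
    (2 + n) * #vertices (suc n)  ∎
    where
    split : ∀ p v → p + 2 * v ≡ v + (p + v)
    split = solve-∀
    merge : ∀ p v → p + (p + v) ≡ 2 * p + v
    merge = solve-∀

-- Indicators of decidable propositions.

indicator : ∀ {P : Set} → Dec P → ℕ
indicator P? = if does P? then 1 else 0

indicator-⇔ : ∀ {P Q : Set} (P? : Dec P) (Q? : Dec Q) → (P → Q) → (Q → P) → indicator P? ≡ indicator Q?
indicator-⇔ (yes p) (yes q) f g = refl
indicator-⇔ (yes p) (no ¬q) f g = contradiction (f p) ¬q
indicator-⇔ (no ¬p) (yes q) f g = contradiction (g q) ¬p
indicator-⇔ (no ¬p) (no ¬q) f g = refl

indicator-no : ∀ {P : Set} (P? : Dec P) → ¬ P → indicator P? ≡ 0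
indicator-no (yes p) ¬p = contradiction p ¬p
indicator-no (no _)  ¬p = refl

indicator-× : ∀ {P Q R : Set} (P? : Dec P) (Q? : Dec Q) (R? : Dec R) →
  (P → Q × R) → (Q → R → P) → indicator P? ≡ indicator Q? * indicator R?
indicator-× P? (yes q) (yes r) f g = indicator-⇔ P? (yes (q , r)) f (uncurry g)
indicator-× P? (yes q) (no ¬r) f g = indicator-no P? (¬r ∘ proj₂ ∘ f)
indicator-× P? (no ¬q) R?      f g = indicator-no P? (¬q ∘ proj₁ ∘ f)

module _ {A : Set} {P : A → Set} (P? : ∀ x → Dec (P x)) where

  length-filter-∷ : ∀ x xs → length (filter P? (x ∷ xs)) ≡ indicator (P? x) + length (filter P? xs)
  length-filter-∷ x xs with does (P? x)
  ... | true  = refl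
  ... | false = refl

  length-filter-++ : ∀ xs ys →
    length (filter P? (xs ++ ys)) ≡ length (filter P? xs) + length (filter P? ys)
  length-filter-++ xs ys = trans (cong length (filter-++ P? xs ys)) (length-++ (filter P? xs))

  length-filter-map : ∀ {B : Set} (f : B → A) xs →
    length (filter P? (map f xs)) ≡ length (filter (P? ∘ f) xs)
  length-filter-map f []       = refl
  length-filter-map f (x ∷ xs) with does (P? (f x))
  ... | true  = cong suc (length-filter-map f xs)
  ... | false = length-filter-map f xs

-- Balanced vertices and their recursion over trees.

-- Being balanced of rank k at the root, in a form that descends through the constructors: one fixed
-- length replaces pairwise equality and the minimum.
AllPathsOfLength : ℕ → Motzkin → Set
AllPathsOfLength k t = All (k ≡_) (toList (rootPathLengths t))

-- Pairwise equal lengths all agree with the first one, which is therefore their minimum.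
balanced⇒allPaths : ∀ {k} t → BalancedOfRank k (root {t}) → AllPathsOfLength k t
balanced⇒allPaths t (balanced , rank≡k) = constant _ balanced rank≡k
  where
  min-constant : ∀ {x} xs → All (x ≡_) xs → foldr₁ ℕ._⊓_ (x List⁺.∷ xs) ≡ x
  min-constant []       []           = refl
  min-constant (x ∷ xs) (refl ∷ x≡) = trans (cong (x ℕ.⊓_) (min-constant xs x≡)) (ℕ.⊓-idem x)
  constant : ∀ {k} ls → AllPairs _≡_ (toList ls) → foldr₁ ℕ._⊓_ ls ≡ k → All (k ≡_) (toList ls)
  constant (x List⁺.∷ xs) (x≡ ∷ _) min≡k with refl ← trans (sym (min-constant xs x≡)) min≡k = refl ∷ x≡

allPaths⇒balanced : ∀ {k} t → AllPathsOfLength k t → BalancedOfRank k (root {t})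
allPaths⇒balanced t all = pairs all , min _ all
  where
  pairs : ∀ {k xs} → All (k ≡_) xs → AllPairs _≡_ xs
  pairs []           = []
  pairs (refl ∷ k≡) = k≡ ∷ pairs k≡
  min : ∀ {k} ls → All (k ≡_) (toList ls) → foldr₁ ℕ._⊓_ ls ≡ k
  min (x List⁺.∷ [])     (refl ∷ [])  = refl
  min (x List⁺.∷ y ∷ xs) (refl ∷ k≡) = trans (cong (x ℕ.⊓_) (min (y List⁺.∷ xs) k≡)) (ℕ.⊓-idem x)

allPaths-unary⁺ : ∀ {k} t → AllPathsOfLength k t → AllPathsOfLength (suc k) (unary t)
allPaths-unary⁺ t = All.map⁺ ∘ All.map (cong suc)

allPaths-unary⁻ : ∀ {k} t → AllPathsOfLength (suc k) (unary t) → AllPathsOfLength k t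
allPaths-unary⁻ t = All.map ℕ.suc-injective ∘ All.map⁻

allPaths-binary⁺ : ∀ {k} t u → AllPathsOfLength k t → AllPathsOfLength k u →
  AllPathsOfLength (suc k) (binary t u)
allPaths-binary⁺ t u all-t all-u = All.map⁺ (All.map (cong suc) (All.++⁺ all-t all-u))

allPaths-binary⁻ : ∀ {k} t u → AllPathsOfLength (suc k) (binary t u) →
  AllPathsOfLength k t × AllPathsOfLength k u
allPaths-binary⁻ t u = All.++⁻ (toList (rootPathLengths t)) ∘ All.map ℕ.suc-injective ∘ All.map⁻

¬allPaths-zero-suc : ∀ ls → ¬ All (0 ≡_) (map suc (toList ls))
¬allPaths-zero-suc ls (() ∷ _)

rootBalanced : ℕ → Motzkin → ℕ
rootBalanced k t = indicator (balancedOfRank? k (root {t}))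

-- `pathLengths` looks only at the subtree of a vertex, so the test at `below v`, `left v` or
-- `right v` computes to the test at `v`.
#balancedIn≗ : ∀ k → #balancedIn k ≗ total (rootBalanced k)
#balancedIn≗ k leaf = trans (length-filter-∷ (balancedOfRank? k) (root {leaf}) []) (ℕ.+-identityʳ _)
#balancedIn≗ k (unary t) = trans
  (length-filter-∷ (balancedOfRank? k) root (map below (vertices t)))
  (cong (rootBalanced k (unary t) +_) (trans
    (length-filter-map (balancedOfRank? k) below (vertices t)) (#balancedIn≗ k t)))
#balancedIn≗ k (binary t u) = trans
  (length-filter-∷ (balancedOfRank? k) root (map left (vertices t) ++ map right (vertices u)))
  (cong (rootBalanced k (binary t u) +_) (trans
    (length-filter-++ (balancedOfRank? k) (map left (vertices t)) (map right (vertices u)))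
    (cong₂ _+_
      (trans (length-filter-map (balancedOfRank? k) left (vertices t)) (#balancedIn≗ k t))
      (trans (length-filter-map (balancedOfRank? k) right (vertices u)) (#balancedIn≗ k u)))))

rootBalanced-zero-unary : ∀ t → rootBalanced 0 (unary t) ≡ 0
rootBalanced-zero-unary t = indicator-no (balancedOfRank? 0 (root {unary t}))
  (¬allPaths-zero-suc (rootPathLengths t) ∘ balanced⇒allPaths (unary t))

rootBalanced-zero-binary : ∀ t u → rootBalanced 0 (binary t u) ≡ 0
rootBalanced-zero-binary t u = indicator-no (balancedOfRank? 0 (root {binary t u}))
  (¬allPaths-zero-suc (rootPathLengths t ⁺++⁺ rootPathLengths u) ∘ balanced⇒allPaths (binary t u))

rootBalanced-suc-leaf : ∀ k → rootBalanced (suc k) leaf ≡ 0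
rootBalanced-suc-leaf k = indicator-no (balancedOfRank? (suc k) (root {leaf})) λ { (_ , ()) }

rootBalanced-suc-unary : ∀ k t → rootBalanced (suc k) (unary t) ≡ rootBalanced k t
rootBalanced-suc-unary k t = indicator-⇔
  (balancedOfRank? (suc k) (root {unary t})) (balancedOfRank? k (root {t}))
  (allPaths⇒balanced t ∘ allPaths-unary⁻ t ∘ balanced⇒allPaths (unary t))
  (allPaths⇒balanced (unary t) ∘ allPaths-unary⁺ t ∘ balanced⇒allPaths t)

-- Every path from a binary root enters one child, so the condition splits over the children;
-- `weight-pairsBelow` turns the product of indicators into a square of series.
rootBalanced-suc-binary : ∀ k t u →
  rootBalanced (suc k) (binary t u) ≡ rootBalanced k t * rootBalanced k u
rootBalanced-suc-binary k t u = indicator-×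
  (balancedOfRank? (suc k) (root {binary t u})) (balancedOfRank? k (root {t})) (balancedOfRank? k (root {u}))
  (λ b → let all-t , all-u = allPaths-binary⁻ t u (balanced⇒allPaths (binary t u) b) in
    allPaths⇒balanced t all-t , allPaths⇒balanced u all-u)
  (λ b b′ → allPaths⇒balanced (binary t u)
    (allPaths-binary⁺ t u (balanced⇒allPaths t b) (balanced⇒allPaths u b′)))

-- Series of trees with a balanced root.

weight-zero : ∀ {A : Set} s (xs : List A) → weight s (λ _ → 0) xs ≗ λ _ → 0
weight-zero s []       n = refl
weight-zero s (x ∷ xs) n = cong₂ _+_ (point-zero (s x) n) (weight-zero s xs n)
  where
  point-zero : ∀ s n → point s 0 n ≡ 0
  point-zero zero    zero    = refl
  point-zero zero    (suc n) = refl
  point-zero (suc s) zero    = refl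
  point-zero (suc s) (suc n) = point-zero s n

gen-zero : gen (λ _ → 0) ≗ λ _ → 0
gen-zero n = trans (sym (weight-trees (λ _ → 0) {n} ℕ.≤-refl)) (weight-zero size (treesOfHeight< n) n)

balancedTrees : ℕ → Series
balancedTrees k = gen (rootBalanced k)

-- A unary or binary root has only paths of positive length, so the leaf alone contributes.
balancedTrees-zero : balancedTrees 0 ≗ shift (point 0 1)
balancedTrees-zero zero    = refl
balancedTrees-zero (suc n) = begin
  balancedTrees 0 (suc n)
    ≡⟨ gen-suc (rootBalanced 0) n ⟩
  point 0 1 n + (gen (rootBalanced 0 ∘ unary) n + weight size² (rootBalanced 0 ∘ uncurry binary) (pairsBelow n) n)
    ≡⟨ cong (point 0 1 n +_) (cong₂ _+_
         (trans (gen-cong rootBalanced-zero-unary n) (gen-zero n))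
         (trans (weight-cong size² (uncurry rootBalanced-zero-binary) (pairsBelow n) n)
           (weight-zero size² (pairsBelow n) n))) ⟩
  point 0 1 n + 0
    ≡⟨ ℕ.+-identityʳ (point 0 1 n) ⟩
  point 0 1 n ∎
  where open ≡-Reasoning

balancedTrees-suc : ∀ k →
  balancedTrees (suc k) ≗ shift (balancedTrees k ⊕ balancedTrees k ⊛ balancedTrees k)
balancedTrees-suc k zero    = refl
balancedTrees-suc k (suc n) = begin
  balancedTrees (suc k) (suc n)
    ≡⟨ gen-suc (rootBalanced (suc k)) n ⟩
  point 0 (rootBalanced (suc k) leaf) n + (gen (rootBalanced (suc k) ∘ unary) n +
    weight size² (rootBalanced (suc k) ∘ uncurry binary) (pairsBelow n) n)
    ≡⟨ cong₂ _+_ (no-leaf n) (cong₂ _+_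
         (gen-cong (rootBalanced-suc-unary k) n)
         (trans (weight-cong size² (uncurry (rootBalanced-suc-binary k)) (pairsBelow n) n)
           (weight-pairsBelow (rootBalanced k) (rootBalanced k) n))) ⟩
  balancedTrees k n + (balancedTrees k ⊛ balancedTrees k) n ∎
  where
  open ≡-Reasoning
  no-leaf : ∀ n → point 0 (rootBalanced (suc k) leaf) n ≡ 0
  no-leaf zero    = rootBalanced-suc-leaf k
  no-leaf (suc n) = refl

#balanced≗ : ∀ k → #balanced k ≗ balancedTrees k ⊛ trinomial
#balanced≗ k n = trans (gen-cong (#balancedIn≗ k) n) (gen-total (rootBalanced k) n)

-- Natural numbers as rationals.

ι : ℕ → ℚ
ι n = pos n ℚ./ 1

toℚᵘ-ι : ∀ n → toℚᵘ (ι n) ≃ mkℚᵘ (pos n) 0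
toℚᵘ-ι n = ℚ.toℚᵘ-fromℚᵘ (mkℚᵘ (pos n) 0)

ι-+ : ∀ m n → ι (m + n) ≡ ι m ℚ.+ ι n
ι-+ m n = ℚ.toℚᵘ-injective (begin
  toℚᵘ (ι (m + n))                    ≈⟨ toℚᵘ-ι (m + n) ⟩
  mkℚᵘ (pos (m + n)) 0                  ≈⟨ *≡* (cong (ℤ._* pos 1) (cong₂ ℤ._+_ (ℤ.*-identityʳ (pos m)) (ℤ.*-identityʳ (pos n)))) ⟨
  mkℚᵘ (pos m) 0 ℚᵘ.+ mkℚᵘ (pos n) 0      ≈⟨ ℚᵘ.+-cong (toℚᵘ-ι m) (toℚᵘ-ι n) ⟨
  toℚᵘ (ι m) ℚᵘ.+ toℚᵘ (ι n)          ≈⟨ ℚ.toℚᵘ-homo-+ (ι m) (ι n) ⟨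
  toℚᵘ (ι m ℚ.+ ι n)                  ∎)
  where open ℚᵘ.≃-Reasoning

ι-* : ∀ m n → ι (m * n) ≡ ι m ℚ.* ι n
ι-* m n = ℚ.toℚᵘ-injective (begin
  toℚᵘ (ι (m * n))                    ≈⟨ toℚᵘ-ι (m * n) ⟩
  mkℚᵘ (pos (m * n)) 0                  ≈⟨ *≡* (cong (ℤ._* pos 1) (ℤ.pos-* m n)) ⟩
  mkℚᵘ (pos m) 0 ℚᵘ.* mkℚᵘ (pos n) 0      ≈⟨ ℚᵘ.*-cong (toℚᵘ-ι m) (toℚᵘ-ι n) ⟨
  toℚᵘ (ι m) ℚᵘ.* toℚᵘ (ι n)          ≈⟨ ℚ.toℚᵘ-homo-* (ι m) (ι n) ⟨
  toℚᵘ (ι m ℚ.* ι n)                  ∎)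
  where open ℚᵘ.≃-Reasoning

/-*-cancel : ∀ a d .{{_ : ℕ.NonZero d}} → (pos a ℚ./ d) ℚ.* ι d ≡ ι a
/-*-cancel a (suc d) = ℚ.toℚᵘ-injective (begin
  toℚᵘ ((pos a ℚ./ suc d) ℚ.* ι (suc d))
    ≈⟨ ℚ.toℚᵘ-homo-* (pos a ℚ./ suc d) (ι (suc d)) ⟩
  toℚᵘ (pos a ℚ./ suc d) ℚᵘ.* toℚᵘ (ι (suc d))
    ≈⟨ ℚᵘ.*-cong (ℚ.toℚᵘ-fromℚᵘ (mkℚᵘ (pos a) d)) (toℚᵘ-ι (suc d)) ⟩
  mkℚᵘ (pos a) d ℚᵘ.* mkℚᵘ (pos (suc d)) 0
    ≈⟨ *≡* (trans (ℤ.*-identityʳ (pos a ℤ.* pos (suc d))) (cong (λ m → pos a ℤ.* pos (suc m)) (sym (ℕ.*-identityʳ d)))) ⟩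
  mkℚᵘ (pos a) 0
    ≈⟨ toℚᵘ-ι a ⟨
  toℚᵘ (ι a) ∎)
  where open ℚᵘ.≃-Reasoning

ι-mono-≤ : ∀ {m n} → m ≤ n → ι m ℚ.≤ ι n
ι-mono-≤ {m} {n} m≤n = ℚ.toℚᵘ-cancel-≤ (begin
  toℚᵘ (ι m)    ≃⟨ toℚᵘ-ι m ⟩
  mkℚᵘ (pos m) 0  ≤⟨ *≤* (ℤ.*-monoʳ-≤-nonNeg (pos 1) (ℤ.+≤+ m≤n)) ⟩
  mkℚᵘ (pos n) 0  ≃⟨ toℚᵘ-ι n ⟨
  toℚᵘ (ι n)    ∎)
  where open ℚᵘ.≤-Reasoning

ι-nonNeg : ∀ n → ℚ.NonNegative (ι n)
ι-nonNeg n = ℚ.nonNegative (ι-mono-≤ {0} {n} z≤n)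

ι-pos : ∀ n .{{_ : ℕ.NonZero n}} → ℚ.Positive (ι n)
ι-pos (suc n) = ℚ.positive (ℚ.<-≤-trans (ℚ.positive⁻¹ (ι 1)) (ι-mono-≤ (s≤s (z≤n {n}))))

archimedean : ∀ q η → 0ℚ ℚ.< η → ∃ λ N → q ℚ.≤ ι N ℚ.* η
-- With r = q/η, the witness is the absolute value of the numerator of r, which bounds r because a
-- denominator is at least 1.
archimedean q η 0<η = ℤ.∣ ℚ.↥ r ∣ , (begin
  q                          ≡⟨ trans (ℚ.*-assoc q (ℚ.1/ η) η)
                                  (trans (cong (q ℚ.*_) (ℚ.*-inverseˡ η)) (ℚ.*-identityʳ q)) ⟨
  r ℚ.* η                    ≤⟨ ℚ.*-monoʳ-≤-nonNeg η {{ℚ.pos⇒nonNeg η}} (≤-numerator r) ⟩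
  ι ℤ.∣ ℚ.↥ r ∣ ℚ.* η        ∎)
  where
  open ℚ.≤-Reasoning
  instance
    η-pos : ℚ.Positive η
    η-pos = ℚ.positive 0<η
    η-nonZero : ℚ.NonZero η
    η-nonZero = ℚ.pos⇒nonZero η
  r = q ℚ.* ℚ.1/ η
  unnormalised : ∀ i d → mkℚᵘ i d ℚᵘ.≤ mkℚᵘ (pos ℤ.∣ i ∣) 0
  unnormalised (pos m)    d = *≤* (ℤ.*-monoˡ-≤-nonNeg (pos m) (ℤ.+≤+ (s≤s z≤n)))
  unnormalised -[1+ m ] d = *≤* ℤ.-≤+
  ≤-numerator : ∀ p → p ℚ.≤ ι ℤ.∣ ℚ.↥ p ∣
  ≤-numerator p@(mkℚ i d _) = ℚ.toℚᵘ-cancel-≤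
    (ℚᵘ.≤-respʳ-≃ (ℚᵘ.≃-sym (toℚᵘ-ι ℤ.∣ i ∣)) (unnormalised i d))

-- Densities relative to the trinomial coefficients.

-- X n / trinomial n tends to c with error O(1/n).
record HasDensity (X : Series) (c : ℚ) : Set where
  constructor withRate
  field
    rate  : ℚ
    bound : ∀ n →
      ι (suc n) ℚ.* ℚ.∣ ι (X n) ℚ.- c ℚ.* ι (trinomial n) ∣ ℚ.≤ rate ℚ.* ι (trinomial n)

-- At n = 0 the bound reads |X 0 - c| ≤ K, since `trinomial 0` is 1.
density-bound≥0 : ∀ {X : Series} {c K} →
  (∀ n → ι (suc n) ℚ.* ℚ.∣ ι (X n) ℚ.- c ℚ.* ι (trinomial n) ∣ ℚ.≤ K ℚ.* ι (trinomial n)) → 0ℚ ℚ.≤ K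
density-bound≥0 {X} {c} {K} bound = begin
  0ℚ                                 ≤⟨ ℚ.0≤∣p∣ (ι (X 0) ℚ.- c ℚ.* 1ℚ) ⟩
  ℚ.∣ ι (X 0) ℚ.- c ℚ.* 1ℚ ∣         ≡⟨ ℚ.*-identityˡ _ ⟨
  1ℚ ℚ.* ℚ.∣ ι (X 0) ℚ.- c ℚ.* 1ℚ ∣  ≤⟨ bound 0 ⟩
  K ℚ.* 1ℚ                           ≡⟨ ℚ.*-identityʳ K ⟩
  K                                  ∎
  where open ℚ.≤-Reasoning

density-cong : ∀ {X Y c d} → X ≗ Y → c ≡ d → HasDensity X c → HasDensity Y d
density-cong {c = c} X≗Y refl (withRate K bound) = withRate K λ n →
  subst (λ x → ι (suc n) ℚ.* ℚ.∣ ι x ℚ.- c ℚ.* ι (trinomial n) ∣ ℚ.≤ K ℚ.* ι (trinomial n))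
    (X≗Y n) (bound n)

density-trinomial : HasDensity trinomial 1ℚ
density-trinomial = withRate 0ℚ λ n → ℚ.≤-reflexive (begin
  ι (suc n) ℚ.* ℚ.∣ ι (trinomial n) ℚ.- 1ℚ ℚ.* ι (trinomial n) ∣
    ≡⟨ cong (λ p → ι (suc n) ℚ.* ℚ.∣ p ∣) (cancel (ι (trinomial n))) ⟩
  ι (suc n) ℚ.* 0ℚ
    ≡⟨ ℚ.*-zeroʳ (ι (suc n)) ⟩
  0ℚ
    ≡⟨ ℚ.*-zeroˡ (ι (trinomial n)) ⟨
  0ℚ ℚ.* ι (trinomial n) ∎)
  where
  open ≡-Reasoning
  cancel : ∀ p → p ℚ.- 1ℚ ℚ.* p ≡ 0ℚ
  cancel = solve 1 (λ p → p :- con 1ℚ :* p := con 0ℚ) refl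
    where open +-*-Solver

density-⊕ : ∀ {X Y c d} → HasDensity X c → HasDensity Y d → HasDensity (X ⊕ Y) (c ℚ.+ d)
density-⊕ {X} {Y} {c} {d} (withRate K boundˣ) (withRate L boundʸ) = withRate (K ℚ.+ L) λ n →
  let p = ι (trinomial n); a = ι (suc n); x = ι (X n); y = ι (Y n) in begin
  a ℚ.* ℚ.∣ ι (X n + Y n) ℚ.- (c ℚ.+ d) ℚ.* p ∣
    ≡⟨ cong (λ z → a ℚ.* ℚ.∣ z ℚ.- (c ℚ.+ d) ℚ.* p ∣) (ι-+ (X n) (Y n)) ⟩
  a ℚ.* ℚ.∣ (x ℚ.+ y) ℚ.- (c ℚ.+ d) ℚ.* p ∣
    ≡⟨ cong (λ z → a ℚ.* ℚ.∣ z ∣) (regroup x y c d p) ⟩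
  a ℚ.* ℚ.∣ (x ℚ.- c ℚ.* p) ℚ.+ (y ℚ.- d ℚ.* p) ∣
    ≤⟨ ℚ.*-monoˡ-≤-nonNeg a {{ι-nonNeg (suc n)}} (ℚ.∣p+q∣≤∣p∣+∣q∣ (x ℚ.- c ℚ.* p) (y ℚ.- d ℚ.* p)) ⟩
  a ℚ.* (ℚ.∣ x ℚ.- c ℚ.* p ∣ ℚ.+ ℚ.∣ y ℚ.- d ℚ.* p ∣)
    ≡⟨ ℚ.*-distribˡ-+ a ℚ.∣ x ℚ.- c ℚ.* p ∣ ℚ.∣ y ℚ.- d ℚ.* p ∣ ⟩
  a ℚ.* ℚ.∣ x ℚ.- c ℚ.* p ∣ ℚ.+ a ℚ.* ℚ.∣ y ℚ.- d ℚ.* p ∣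
    ≤⟨ ℚ.+-mono-≤ (boundˣ n) (boundʸ n) ⟩
  K ℚ.* p ℚ.+ L ℚ.* p
    ≡⟨ ℚ.*-distribʳ-+ p K L ⟨
  (K ℚ.+ L) ℚ.* p ∎
  where
  open ℚ.≤-Reasoning
  regroup : ∀ x y c d p → (x ℚ.+ y) ℚ.- (c ℚ.+ d) ℚ.* p ≡ (x ℚ.- c ℚ.* p) ℚ.+ (y ℚ.- d ℚ.* p)
  regroup = solve 5 (λ x y c d p → (x :+ y) :- (c :+ d) :* p := (x :- c :* p) :+ (y :- d :* p)) refl
    where open +-*-Solver

-- `trinomial-bounds` as an error estimate: 0 ≤ 1 - v/p ≤ 1/(1 + n), where p is `trinomial n` and v
-- is `#vertices n`.
vertex-deficit : ∀ n →
  0ℚ ℚ.≤ ι (trinomial n) ℚ.- ι (#vertices n) ×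
  ι (suc n) ℚ.* (ι (trinomial n) ℚ.- ι (#vertices n)) ℚ.≤ ι (trinomial n)
vertex-deficit n with trinomial-bounds n
... | v≤p , np≤[1+n]v =
  subst (ℚ._≤ p ℚ.- v) (ℚ.+-inverseʳ v) (ℚ.+-monoˡ-≤ (ℚ.- v) (ι-mono-≤ v≤p)) , (begin
  ι (suc n) ℚ.* (p ℚ.- v)
    ≡⟨ expand (ι (suc n)) p v ⟩
  ι (suc n) ℚ.* p ℚ.+ ℚ.- (ι (suc n) ℚ.* v)
    ≡⟨ cong₂ (λ x y → x ℚ.+ ℚ.- y) (sym (ι-* (suc n) (trinomial n))) (sym (ι-* (suc n) (#vertices n))) ⟩
  ι (suc n * trinomial n) ℚ.+ ℚ.- ι (suc n * #vertices n)
    -- `suc n * trinomial n` unfolds to `trinomial n + n * trinomial n`, whose second summand is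
    -- bounded.
    ≤⟨ ℚ.+-monoˡ-≤ (ℚ.- ι (suc n * #vertices n)) (ι-mono-≤ (ℕ.+-monoʳ-≤ (trinomial n) np≤[1+n]v)) ⟩
  ι (trinomial n + suc n * #vertices n) ℚ.+ ℚ.- ι (suc n * #vertices n)
    ≡⟨ cong (ℚ._- ι (suc n * #vertices n)) (ι-+ (trinomial n) (suc n * #vertices n)) ⟩
  (p ℚ.+ ι (suc n * #vertices n)) ℚ.- ι (suc n * #vertices n)
    ≡⟨ cancel p (ι (suc n * #vertices n)) ⟩
  p ∎)
  where
  open ℚ.≤-Reasoning
  p = ι (trinomial n)
  v = ι (#vertices n)
  expand : ∀ a p v → a ℚ.* (p ℚ.- v) ≡ a ℚ.* p ℚ.+ ℚ.- (a ℚ.* v)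
  expand = solve 3 (λ a p v → a :* (p :- v) := a :* p :+ :- (a :* v)) refl
    where open +-*-Solver
  cancel : ∀ p q → (p ℚ.+ q) ℚ.- q ≡ p
  cancel = solve 2 (λ p q → (p :+ q) :- q := p) refl
    where open +-*-Solver

-- Since p(n+1) = p + 2v = 3p - 2(p - v), the error splits as x - (c/3) p(n+1) = (x - cp) + (c/3)
-- 2(p - v). The first summand is small by hypothesis, the second by `vertex-deficit`.
density-shift : ∀ {X c} → HasDensity X c → HasDensity (shift X) ((pos 1 ℚ./ 3) ℚ.* c)
density-shift {X} {c} (withRate K bound) = withRate K′ bound′
  where
  open ℚ.≤-Reasoning
  L = ℚ.∣ (pos 1 ℚ./ 3) ℚ.* c ∣
  2ℚ = ι 2
  -- The outer 2 pays for 2 + n ≤ 2 (1 + n); the inner 2 comes from 2 (p - v).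
  K′ = 2ℚ ℚ.* (K ℚ.+ 2ℚ ℚ.* L)
  0≤K : 0ℚ ℚ.≤ K
  0≤K = density-bound≥0 {X} {c} bound
  0≤K+L : 0ℚ ℚ.≤ K ℚ.+ 2ℚ ℚ.* L
  0≤K+L = ℚ.+-mono-≤ 0≤K (ℚ.*-monoˡ-≤-nonNeg 2ℚ (ℚ.0≤∣p∣ ((pos 1 ℚ./ 3) ℚ.* c)))
  0≤K′ : 0ℚ ℚ.≤ K′
  0≤K′ = ℚ.*-monoˡ-≤-nonNeg 2ℚ 0≤K+L
  bound′ : ∀ n → ι (suc n) ℚ.* ℚ.∣ ι (shift X n) ℚ.- (pos 1 ℚ./ 3) ℚ.* c ℚ.* ι (trinomial n) ∣
    ℚ.≤ K′ ℚ.* ι (trinomial n)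
  -- `shift X 0` is 0, so the whole error is L = |c/3|, which `K′` covers.
  bound′ zero = begin
    1ℚ ℚ.* ℚ.∣ 0ℚ ℚ.- t ℚ.* 1ℚ ∣   ≡⟨ ℚ.*-identityˡ _ ⟩
    ℚ.∣ 0ℚ ℚ.- t ℚ.* 1ℚ ∣          ≡⟨ cong ℚ.∣_∣ (negate t) ⟩
    ℚ.∣ ℚ.- t ∣                    ≡⟨ ℚ.∣-p∣≡∣p∣ t ⟩
    L                              ≡⟨ ℚ.+-identityʳ L ⟨
    L ℚ.+ 0ℚ                       ≤⟨ ℚ.+-monoʳ-≤ L (ℚ.+-mono-≤ (ℚ.+-mono-≤ 0≤L 0≤2L) (ℚ.+-mono-≤ 0≤K 0≤K)) ⟩
    L ℚ.+ ((L ℚ.+ 2ℚ ℚ.* L) ℚ.+ (K ℚ.+ K)) ≡⟨ collect K L ⟩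
    K′ ℚ.* 1ℚ                      ∎
    where
    t = (pos 1 ℚ./ 3) ℚ.* c
    0≤L : 0ℚ ℚ.≤ L
    0≤L = ℚ.0≤∣p∣ t
    0≤2L : 0ℚ ℚ.≤ 2ℚ ℚ.* L
    0≤2L = ℚ.*-monoˡ-≤-nonNeg 2ℚ 0≤L
    negate : ∀ t → 0ℚ ℚ.- t ℚ.* 1ℚ ≡ ℚ.- t
    negate = solve 1 (λ t → con 0ℚ :- t :* con 1ℚ := :- t) refl
      where open +-*-Solver
    collect : ∀ K L → L ℚ.+ ((L ℚ.+ 2ℚ ℚ.* L) ℚ.+ (K ℚ.+ K)) ≡ 2ℚ ℚ.* (K ℚ.+ 2ℚ ℚ.* L) ℚ.* 1ℚ
    collect = solve 2 (λ K L → L :+ ((L :+ con 2ℚ :* L) :+ (K :+ K)) :=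
      con 2ℚ :* (K :+ con 2ℚ :* L) :* con 1ℚ) refl
      where open +-*-Solver
  bound′ (suc n) = begin
    ι (2 + n) ℚ.* ℚ.∣ x ℚ.- t ℚ.* ι (trinomial (suc n)) ∣
      ≡⟨ cong (λ q → ι (2 + n) ℚ.* ℚ.∣ x ℚ.- t ℚ.* q ∣) p′≡ ⟩
    ι (2 + n) ℚ.* ℚ.∣ x ℚ.- t ℚ.* (p ℚ.+ 2ℚ ℚ.* v) ∣
      ≡⟨ cong (λ q → ι (2 + n) ℚ.* ℚ.∣ q ∣) (regroup x c p v) ⟩
    ι (2 + n) ℚ.* ℚ.∣ (x ℚ.- c ℚ.* p) ℚ.+ t ℚ.* (2ℚ ℚ.* (p ℚ.- v)) ∣
      ≤⟨ ℚ.*-monoˡ-≤-nonNeg (ι (2 + n)) {{ι-nonNeg (2 + n)}}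
           (ℚ.∣p+q∣≤∣p∣+∣q∣ (x ℚ.- c ℚ.* p) (t ℚ.* (2ℚ ℚ.* (p ℚ.- v)))) ⟩
    ι (2 + n) ℚ.* (e ℚ.+ ℚ.∣ t ℚ.* (2ℚ ℚ.* (p ℚ.- v)) ∣)
      ≡⟨ cong (λ q → ι (2 + n) ℚ.* (e ℚ.+ q)) (trans (ℚ.∣p*q∣≡∣p∣*∣q∣ t (2ℚ ℚ.* (p ℚ.- v)))
           (cong (L ℚ.*_) (ℚ.0≤p⇒∣p∣≡p 0≤2[p-v]))) ⟩
    ι (2 + n) ℚ.* (e ℚ.+ L ℚ.* (2ℚ ℚ.* (p ℚ.- v)))
      ≤⟨ ℚ.*-monoʳ-≤-nonNeg _ {{ℚ.nonNegative (ℚ.+-mono-≤ (ℚ.0≤∣p∣ (x ℚ.- c ℚ.* p)) 0≤L2[p-v])}}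
           (ι-mono-≤ 2+n≤2[1+n]) ⟩
    ι (2 * suc n) ℚ.* (e ℚ.+ L ℚ.* (2ℚ ℚ.* (p ℚ.- v)))
      ≡⟨ cong (ℚ._* (e ℚ.+ L ℚ.* (2ℚ ℚ.* (p ℚ.- v)))) (ι-* 2 (suc n)) ⟩
    2ℚ ℚ.* ι (suc n) ℚ.* (e ℚ.+ L ℚ.* (2ℚ ℚ.* (p ℚ.- v)))
      ≡⟨ distribute (ι (suc n)) e L (p ℚ.- v) ⟩
    2ℚ ℚ.* (ι (suc n) ℚ.* e ℚ.+ 2ℚ ℚ.* L ℚ.* (ι (suc n) ℚ.* (p ℚ.- v)))
      ≤⟨ ℚ.*-monoˡ-≤-nonNeg 2ℚ (ℚ.+-mono-≤ (bound n)
           (ℚ.*-monoˡ-≤-nonNeg (2ℚ ℚ.* L) {{ℚ.nonNegative (ℚ.*-monoˡ-≤-nonNeg 2ℚ 0≤L)}} (proj₂ (vertex-deficit n)))) ⟩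
    2ℚ ℚ.* (K ℚ.* p ℚ.+ 2ℚ ℚ.* L ℚ.* p)
      ≡⟨ collect K L p ⟩
    K′ ℚ.* p
      -- The bound at p(n) passes to p(n+1), which is no smaller.
      ≤⟨ ℚ.*-monoˡ-≤-nonNeg K′ {{ℚ.nonNegative 0≤K′}} (ι-mono-≤ (ℕ.m≤m+n (trinomial n) (2 * #vertices n))) ⟩
    K′ ℚ.* ι (trinomial (suc n)) ∎
    where
    t = (pos 1 ℚ./ 3) ℚ.* c
    x = ι (X n)
    p = ι (trinomial n)
    v = ι (#vertices n)
    e = ℚ.∣ x ℚ.- c ℚ.* p ∣
    0≤L : 0ℚ ℚ.≤ L
    0≤L = ℚ.0≤∣p∣ t
    0≤2[p-v] : 0ℚ ℚ.≤ 2ℚ ℚ.* (p ℚ.- v)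
    0≤2[p-v] = ℚ.*-monoˡ-≤-nonNeg 2ℚ (proj₁ (vertex-deficit n))
    0≤L2[p-v] : 0ℚ ℚ.≤ L ℚ.* (2ℚ ℚ.* (p ℚ.- v))
    0≤L2[p-v] = subst (ℚ._≤ L ℚ.* (2ℚ ℚ.* (p ℚ.- v))) (ℚ.*-zeroʳ L)
      (ℚ.*-monoˡ-≤-nonNeg L {{ℚ.nonNegative 0≤L}} 0≤2[p-v])
    2+n≤2[1+n] : 2 + n ≤ 2 * suc n
    2+n≤2[1+n] = s≤s (ℕ.≤-trans (ℕ.m≤m+n (suc n) n) (ℕ.≤-reflexive (lemma n)))
      where
      lemma : ∀ n → suc n + n ≡ n + 1 * suc n
      lemma = solve-∀
    p′≡ : ι (trinomial (suc n)) ≡ p ℚ.+ 2ℚ ℚ.* v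
    p′≡ = trans (ι-+ (trinomial n) (2 * #vertices n)) (cong (p ℚ.+_) (ι-* 2 (#vertices n)))
    regroup : ∀ x c p v → x ℚ.- (pos 1 ℚ./ 3) ℚ.* c ℚ.* (p ℚ.+ 2ℚ ℚ.* v) ≡
      (x ℚ.- c ℚ.* p) ℚ.+ (pos 1 ℚ./ 3) ℚ.* c ℚ.* (2ℚ ℚ.* (p ℚ.- v))
    regroup = solve 4 (λ x c p v → x :- con (pos 1 ℚ./ 3) :* c :* (p :+ con 2ℚ :* v) :=
      (x :- c :* p) :+ con (pos 1 ℚ./ 3) :* c :* (con 2ℚ :* (p :- v))) refl
      where open +-*-Solver
    distribute : ∀ a e L d → 2ℚ ℚ.* a ℚ.* (e ℚ.+ L ℚ.* (2ℚ ℚ.* d)) ≡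
      2ℚ ℚ.* (a ℚ.* e ℚ.+ 2ℚ ℚ.* L ℚ.* (a ℚ.* d))
    distribute = solve 4 (λ a e L d → con 2ℚ :* a :* (e :+ L :* (con 2ℚ :* d)) :=
      con 2ℚ :* (a :* e :+ con 2ℚ :* L :* (a :* d))) refl
      where open +-*-Solver
    collect : ∀ K L p → 2ℚ ℚ.* (K ℚ.* p ℚ.+ 2ℚ ℚ.* L ℚ.* p) ≡ 2ℚ ℚ.* (K ℚ.+ 2ℚ ℚ.* L) ℚ.* p
    collect = solve 3 (λ K L p → con 2ℚ :* (K :* p :+ con 2ℚ :* L :* p) :=
      con 2ℚ :* (K :+ con 2ℚ :* L) :* p) refl
      where open +-*-Solver

shift-cong : ∀ {f g} → f ≗ g → shift f ≗ shift g
shift-cong p zero    = refl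
shift-cong p (suc n) = p n

-- Limiting densities of balanced vertices.

-- The recurrence of the theorem serves as the definition, so every limit is rational. The initial
-- 1/3 is the effect of multiplying by B 0 = z.
balancedDensity : ℕ → ℚ
balancedDensity zero    = pos 1 ℚ./ 3
balancedDensity (suc k) = (pos 1 ℚ./ 3) ℚ.* d ℚ.+ (pos 1 ℚ./ 3) ℚ.* (d ℚ.* d)
  where d = balancedDensity k

-- Quantifying over X lets the induction hypothesis be applied twice, which gives B k (B k X) the
-- factor (b k)²; `density-shift` then supplies the 1/3.
density-balancedTrees : ∀ k {X c} → HasDensity X c →
  HasDensity (balancedTrees k ⊛ X) (balancedDensity k ℚ.* c)
density-balancedTrees zero {X} dense = density-cong unshift refl (density-shift dense)
  where
  open ≡-Reasoning
  unshift : shift X ≗ balancedTrees 0 ⊛ X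
  unshift n = begin
    shift X n                ≡⟨ shift-cong (λ i → trans (point-zero-⊛ 1 X i) (ℕ.*-identityˡ (X i))) n ⟨
    shift (point 0 1 ⊛ X) n  ≡⟨ ⊛-shiftˡ (point 0 1) X n ⟨
    (shift (point 0 1) ⊛ X) n ≡⟨ ⊛-cong {g = X} balancedTrees-zero (λ _ → refl) n ⟨
    (balancedTrees 0 ⊛ X) n  ∎
density-balancedTrees (suc k) {X} {c} dense = density-cong unshift (distribute (balancedDensity k) c)
  (density-shift (density-⊕ (density-balancedTrees k dense)
    (density-balancedTrees k (density-balancedTrees k dense))))
  where
  open ≡-Reasoning
  B = balancedTrees k
  unshift : shift (B ⊛ X ⊕ B ⊛ (B ⊛ X)) ≗ balancedTrees (suc k) ⊛ X
  unshift n = begin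
    shift (B ⊛ X ⊕ B ⊛ (B ⊛ X)) n
      ≡⟨ shift-cong (λ i → trans (⊛-distribʳ B (B ⊛ B) X i)
           (cong ((B ⊛ X) i +_) (⊛-assoc B B X i))) n ⟨
    shift ((B ⊕ B ⊛ B) ⊛ X) n
      ≡⟨ ⊛-shiftˡ (B ⊕ B ⊛ B) X n ⟨
    (shift (B ⊕ B ⊛ B) ⊛ X) n
      ≡⟨ ⊛-cong {g = X} (balancedTrees-suc k) (λ _ → refl) n ⟨
    (balancedTrees (suc k) ⊛ X) n ∎
  distribute : ∀ d c → (pos 1 ℚ./ 3) ℚ.* (d ℚ.* c ℚ.+ d ℚ.* (d ℚ.* c)) ≡
    ((pos 1 ℚ./ 3) ℚ.* d ℚ.+ (pos 1 ℚ./ 3) ℚ.* (d ℚ.* d)) ℚ.* c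
  distribute = solve 2 (λ d c → con (pos 1 ℚ./ 3) :* (d :* c :+ d :* (d :* c)) :=
    (con (pos 1 ℚ./ 3) :* d :+ con (pos 1 ℚ./ 3) :* (d :* d)) :* c) refl
    where open +-*-Solver

density-#balanced : ∀ k → HasDensity (#balanced k) (balancedDensity k)
density-#balanced k = density-cong (sym ∘ #balanced≗ k) (ℚ.*-identityʳ (balancedDensity k))
  (density-balancedTrees k density-trinomial)

-- Convergence of the proportions.

-- From n p ≤ (1 + n) v ≤ 2n v. Positivity of n matters: at 0 the values are p = 1 and v = 0.
trinomial≤2#vertices : ∀ n .{{_ : ℕ.NonZero n}} → trinomial n ≤ 2 * #vertices n
trinomial≤2#vertices n@(suc m) = ℕ.*-cancelˡ-≤ n (begin
  n * trinomial n                   ≤⟨ proj₂ (trinomial-bounds n) ⟩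
  (1 + n) * #vertices n             ≤⟨ ℕ.*-monoˡ-≤ (#vertices n) (ℕ.+-monoˡ-≤ n (s≤s (z≤n {m}))) ⟩
  (n + n) * #vertices n             ≡⟨ double n (#vertices n) ⟩
  n * (2 * #vertices n)             ∎)
  where
  open ℕ.≤-Reasoning
  double : ∀ n v → (n + n) * v ≡ n * (2 * v)
  double = solve-∀

-- Changes the normalisation from p to v through (x - c) v = (x v - c p) + c (p - v). Both terms are
-- O(p/n), and p ≤ 2v gives the factor 2 when v is cancelled.
proportion-close : ∀ {X c} → HasDensity X c → ∃ λ K → ∀ n .{{_ : ℕ.NonZero n}} x →
  x ℚ.* ι (#vertices n) ≡ ι (X n) → ι (suc n) ℚ.* ℚ.∣ x ℚ.- c ∣ ℚ.≤ K
proportion-close {X} {c} (withRate K bound) = 2ℚ ℚ.* (K ℚ.+ ℚ.∣ c ∣) , close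
  where
  open ℚ.≤-Reasoning
  2ℚ = ι 2
  close : ∀ n .{{_ : ℕ.NonZero n}} x → x ℚ.* ι (#vertices n) ≡ ι (X n) →
    ι (suc n) ℚ.* ℚ.∣ x ℚ.- c ∣ ℚ.≤ 2ℚ ℚ.* (K ℚ.+ ℚ.∣ c ∣)
  close n x xv≡X = ℚ.*-cancelʳ-≤-pos v {{v-pos}} (begin
    a ℚ.* ℚ.∣ x ℚ.- c ∣ ℚ.* v
      ≡⟨ cong (a ℚ.* ℚ.∣ x ℚ.- c ∣ ℚ.*_) (ℚ.0≤p⇒∣p∣≡p (ℚ.nonNegative⁻¹ v {{ι-nonNeg (#vertices n)}})) ⟨
    a ℚ.* ℚ.∣ x ℚ.- c ∣ ℚ.* ℚ.∣ v ∣
      ≡⟨ trans (ℚ.*-assoc a ℚ.∣ x ℚ.- c ∣ ℚ.∣ v ∣) (cong (a ℚ.*_) (sym (ℚ.∣p*q∣≡∣p∣*∣q∣ (x ℚ.- c) v))) ⟩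
    a ℚ.* ℚ.∣ (x ℚ.- c) ℚ.* v ∣
      ≡⟨ cong (λ q → a ℚ.* ℚ.∣ q ∣) (regroup x c v p) ⟩
    a ℚ.* ℚ.∣ (x ℚ.* v ℚ.- c ℚ.* p) ℚ.+ c ℚ.* (p ℚ.- v) ∣
      ≤⟨ ℚ.*-monoˡ-≤-nonNeg a {{ι-nonNeg (suc n)}} (ℚ.∣p+q∣≤∣p∣+∣q∣ (x ℚ.* v ℚ.- c ℚ.* p) (c ℚ.* (p ℚ.- v))) ⟩
    a ℚ.* (ℚ.∣ x ℚ.* v ℚ.- c ℚ.* p ∣ ℚ.+ ℚ.∣ c ℚ.* (p ℚ.- v) ∣)
      ≡⟨ cong₂ (λ q r → a ℚ.* (ℚ.∣ q ℚ.- c ℚ.* p ∣ ℚ.+ r)) xv≡X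
           (trans (ℚ.∣p*q∣≡∣p∣*∣q∣ c (p ℚ.- v))
                  (cong (ℚ.∣ c ∣ ℚ.*_) (ℚ.0≤p⇒∣p∣≡p (proj₁ (vertex-deficit n))))) ⟩
    a ℚ.* (e ℚ.+ ℚ.∣ c ∣ ℚ.* (p ℚ.- v))
      ≡⟨ distribute a e ℚ.∣ c ∣ (p ℚ.- v) ⟩
    a ℚ.* e ℚ.+ ℚ.∣ c ∣ ℚ.* (a ℚ.* (p ℚ.- v))
      ≤⟨ ℚ.+-mono-≤ (bound n)
           (ℚ.*-monoˡ-≤-nonNeg ℚ.∣ c ∣ {{ℚ.∣-∣-nonNeg c}} (proj₂ (vertex-deficit n))) ⟩
    K ℚ.* p ℚ.+ ℚ.∣ c ∣ ℚ.* p
      ≡⟨ ℚ.*-distribʳ-+ p K ℚ.∣ c ∣ ⟨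
    (K ℚ.+ ℚ.∣ c ∣) ℚ.* p
      ≤⟨ ℚ.*-monoˡ-≤-nonNeg (K ℚ.+ ℚ.∣ c ∣) {{ℚ.nonNegative (ℚ.+-mono-≤ 0≤K (ℚ.0≤∣p∣ c))}}
           (ι-mono-≤ (trinomial≤2#vertices n)) ⟩
    (K ℚ.+ ℚ.∣ c ∣) ℚ.* ι (2 * #vertices n)
      ≡⟨ cong ((K ℚ.+ ℚ.∣ c ∣) ℚ.*_) (ι-* 2 (#vertices n)) ⟩
    (K ℚ.+ ℚ.∣ c ∣) ℚ.* (2ℚ ℚ.* v)
      ≡⟨ trans (sym (ℚ.*-assoc (K ℚ.+ ℚ.∣ c ∣) 2ℚ v)) (cong (ℚ._* v) (ℚ.*-comm (K ℚ.+ ℚ.∣ c ∣) 2ℚ)) ⟩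
    2ℚ ℚ.* (K ℚ.+ ℚ.∣ c ∣) ℚ.* v ∎)
    where
    a = ι (suc n)
    v = ι (#vertices n)
    p = ι (trinomial n)
    e = ℚ.∣ ι (X n) ℚ.- c ℚ.* p ∣
    v-pos : ℚ.Positive v
    v-pos = subst (λ m → ℚ.Positive (ι m)) (sym (#vertices≡ n))
      (ι-pos (n * #trees n) {{ℕ.m*n≢0 n (#trees n) {{it}} {{#trees-nonZero n}}}})
    0≤K : 0ℚ ℚ.≤ K
    0≤K = density-bound≥0 {X} {c} bound
    regroup : ∀ x c v p → (x ℚ.- c) ℚ.* v ≡ (x ℚ.* v ℚ.- c ℚ.* p) ℚ.+ c ℚ.* (p ℚ.- v)
    regroup = solve 4 (λ x c v p → (x :- c) :* v := (x :* v :- c :* p) :+ c :* (p :- v)) refl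
      where open +-*-Solver
    distribute : ∀ a e L d → a ℚ.* (e ℚ.+ L ℚ.* d) ≡ a ℚ.* e ℚ.+ L ℚ.* (a ℚ.* d)
    distribute = solve 4 (λ a e L d → a :* (e :+ L :* d) := a :* e :+ L :* (a :* d)) refl
      where open +-*-Solver

balancedProportion-* : ∀ k n .{{_ : ℕ.NonZero n}} →
  balancedProportion k n ℚ.* ι (#vertices n) ≡ ι (#balanced k n)
balancedProportion-* k n = trans (cong (λ m → balancedProportion k n ℚ.* ι m) (#vertices≡ n))
  (/-*-cancel (#balanced k n) (n * #trees n) {{ℕ.m*n≢0 n (#trees n) {{it}} {{#trees-nonZero n}}}})

balancedProportion-converges : ∀ k →
  ConvergesTo (λ j → fromℚ (balancedProportion k (suc j))) (fromℚ (balancedDensity k))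
-- The gap demanded by `_<ᴿ_` is the half of ε that the distance leaves over; all reals here are
-- constant sequences, so the inner index is 0.
balancedProportion-converges k ε 0<ε = N , λ j N≤j → ½ε , 0<½ε , 0 , λ _ _ → within j N≤j
  where
  open ℚ.≤-Reasoning
  c = balancedDensity k
  x : ℕ → ℚ
  x j = balancedProportion k (suc j)
  ½ε = ½ ℚ.* ε
  0<½ε : 0ℚ ℚ.< ½ε
  0<½ε = ℚ.*-monoʳ-<-pos ½ 0<ε
  K = proj₁ (proportion-close (density-#balanced k))
  N = proj₁ (archimedean K ½ε 0<½ε)
  -- `x j` is the proportion at n = j + 1, hence the factor 2 + j.
  near : ∀ j → N ≤ j → ι (2 + j) ℚ.* ℚ.∣ x j ℚ.- c ∣ ℚ.≤ ι (2 + j) ℚ.* ½ε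
  near j N≤j = begin
    ι (2 + j) ℚ.* ℚ.∣ x j ℚ.- c ∣
      ≤⟨ proj₂ (proportion-close (density-#balanced k)) (suc j) (x j) (balancedProportion-* k (suc j)) ⟩
    K
      ≤⟨ proj₂ (archimedean K ½ε 0<½ε) ⟩
    ι N ℚ.* ½ε
      ≤⟨ ℚ.*-monoʳ-≤-nonNeg ½ε {{ℚ.nonNegative (ℚ.<⇒≤ 0<½ε)}} (ι-mono-≤ (ℕ.≤-trans N≤j (ℕ.m≤n+m j 2))) ⟩
    ι (2 + j) ℚ.* ½ε ∎
  within : ∀ j → N ≤ j → ℚ.∣ x j ℚ.- c ∣ ℚ.+ ½ε ℚ.≤ ε
  within j N≤j = begin
    ℚ.∣ x j ℚ.- c ∣ ℚ.+ ½ε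
      ≤⟨ ℚ.+-monoˡ-≤ ½ε (ℚ.*-cancelˡ-≤-pos (ι (2 + j)) {{ι-pos (2 + j)}} (near j N≤j)) ⟩
    ½ε ℚ.+ ½ε      ≡⟨ ℚ.*-distribʳ-+ ε ½ ½ ⟨
    1ℚ ℚ.* ε       ≡⟨ ℚ.*-identityˡ ε ⟩
    ε              ∎

theorem4p3 : Σ (ℕ → ℝ) λ b →
    (∀ k → ConvergesTo (λ j → fromℚ (balancedProportion k (suc j))) (b k))
    × (∀ k → b (suc k) ≃ᴿ ⅓ *ᴿ b k +ᴿ ⅓ *ᴿ (b k *ᴿ b k))
-- All reals in the recurrence are constant sequences, and its two sides agree by the definition of
-- `balancedDensity`, so the difference has the form p - p.
theorem4p3 = fromℚ ∘ balancedDensity , balancedProportion-converges , λ k ε 0<ε →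
  0 , λ _ _ → subst (ℚ._< ε) (sym (cong ℚ.∣_∣ (ℚ.+-inverseʳ (balancedDensity (suc k))))) 0<ε
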